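{- Let $A=\begin{pmatrix}a_{1,1}&a_{1,2}\\ a_{2,1}&a_{2,2}\end{pmatrix}$ be a real matrix with $\det A\ne0$, and let $\Lambda=A\mathbb{Z}^2$. Assume that $a_{1,1}\neq 0$, $a_{2,2}\ne0$ and that the numbers $$\theta=\frac{a_{1,2}}{a_{1,1}},\qquad \eta=\frac{a_{2,1}}{a_{2,2}}$$ are irrational. Then $$\omega_\Lambda\ \ge\ \mathfrak{G}_{\overline{\omega}_\Lambda}\cdot\overline{\omega}_\Lambda,$$ where, for real $y\ge 0$, $\mathfrak{G}_y$ denotes the positive root of the polynomial $\mathscr{G}_y(x)=x^2-2yx-1$.
   Context: For a two-dimensional lattice $\Lambda=A\mathbb{Z}^2\subset\mathbb{R}^2$ ($A$ a real $2\times2$ matrix with $\det A\neq0$) define $$\Psi_\Lambda(t)=\min_{x=(x_1,x_2)\in\Lambda:\ 0<\max(|x_1|,|x_2|)\le t}|x_1x_2|^{1/2}$$ for all $t$ large enough that the set is non-empty. The ordinary Diophantine exponent of the lattice is $$\omega_\Lambda=\sup\{\gamma\in\mathbb{R}:\ \liminf_{t\to\infty}t^{\gamma}\,\Psi_\Lambda(t)<\infty\},$$ and the weak uniform Diophantine exponent of the lattice is $$\overline{\omega}_\Lambda=\sup\{\gamma\in\mathbb{R}:\ \limsup_{t\to\infty}t^{\gamma}\,\Psi_\Lambda(t)<\infty\}.$$ Both exponents take values in $[0,+\infty]$. If $\overline{\omega}_\Lambda=+\infty$, the product $\mathfrak{G}_{\overline{\omega}_\Lambda}\cdot\overline{\omega}_\Lambda$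 is interpreted as $+\infty$. -}

module Defs where

open import Algebra.Bundles using (CommutativeRing)
import Algebra.Construct.NaturalChoice.Max as Max
import Algebra.Properties.Semiring.Exp as Exp
import Algebra.Properties.Semiring.Mult as Mult
open import Axiom.ExcludedMiddle using (ExcludedMiddle)
open import Data.Bool.Base using (if_then_else_)
open import Data.Fin.Base using (Fin)
open import Data.Fin.Patterns using (0F; 1F)
open import Data.Integer.Base using (ℤ; +_; -[1+_])
open import Data.Nat.Base using (ℕ; suc)
open import Data.Product.Base using (∃; ∃-syntax; ∃₂; _×_; _,_)
open import Data.Rational.Base using (ℚ; ↥_; ↧ₙ_)
open import Function.Base using (flip)
open import Level using (0ℓ)
open import Relation.Binary.Bundles using (TotalOrder)
open import Relation.Binary.Core using (Rel)
import Relation.Binary.Construct.Add.Extrema.NonStrict as ExtremaNonStrict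
import Relation.Binary.Construct.Add.Extrema.Strict as ExtremaStrict
import Relation.Binary.Construct.NonStrictToStrict as NonStrictToStrict
open import Relation.Binary.Structures using (IsTotalOrder)
open import Relation.Nullary.Construct.Add.Extrema using (_±; ⊥±; [_]; ⊤±)
open import Relation.Nullary.Decidable.Core using (Dec; yes; no; does)
open import Relation.Unary using (Pred)

IsLub : {X : Set} → Rel X 0ℓ → {I : Set} → (I → X) → X → Set
IsLub _≤_ f s = (∀ i → f i ≤ s) × (∀ u → (∀ i → f i ≤ u) → s ≤ u)

IsGlb : {X : Set} → Rel X 0ℓ → {I : Set} → (I → X) → X → Set
IsGlb _≤_ = IsLub (flip _≤_)

-- The second-order axioms of the real line, which in the presence of
-- excluded middle determine it up to unique isomorphism.  The value of
-- 0# ⁻¹ is left unspecified.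
record CompleteOrderedField : Set₁ where
  infix  8 _⁻¹
  infix  4 _≤_
  field
    commutativeRing : CommutativeRing 0ℓ 0ℓ

  open CommutativeRing commutativeRing public

  field
    _⁻¹          : Carrier → Carrier
    ⁻¹-inverseʳ  : ∀ x → x ≉ 0# → x * x ⁻¹ ≈ 1#
    0≉1          : 0# ≉ 1#
    _≤_          : Rel Carrier 0ℓ
    isTotalOrder : IsTotalOrder _≈_ _≤_
    +-monoʳ-≤    : ∀ x {y z} → y ≤ z → x + y ≤ x + z
    *-nonNeg     : ∀ {x y} → 0# ≤ x → 0# ≤ y → 0# ≤ x * y
    complete     : {I : Set} (f : I → Carrier) → I →
                   ∃[ b ] (∀ i → f i ≤ b) → ∃ (IsLub _≤_ f)

  totalOrder : TotalOrder 0ℓ 0ℓ 0ℓ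
  totalOrder = record { isTotalOrder = isTotalOrder }

  open NonStrictToStrict _≈_ _≤_ public using (_<_)
  open Max totalOrder public using (_⊔_)
  open Exp semiring public using (_^_)
  open Mult semiring public using () renaming (_×_ to _·_)

  infixl 7 _/_
  _/_ : Carrier → Carrier → Carrier
  x / y = x * y ⁻¹

  ∣_∣ : Carrier → Carrier
  ∣ x ∣ = x ⊔ (- x)

  fromℤ : ℤ → Carrier
  fromℤ (+ n)    = n · 1#
  fromℤ -[1+ n ] = - (suc n · 1#)

  fromℚ : ℚ → Carrier
  fromℚ q = fromℤ (↥ q) / fromℤ (+ ↧ₙ q)

  Irrational : Carrier → Set
  Irrational x = ∀ q → x ≉ fromℚ q

module LatticeExponents (em : ExcludedMiddle 0ℓ) (R : CompleteOrderedField) where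

  open CompleteOrderedField R renaming (Carrier to ℝ)
  open ExtremaNonStrict _≤_ public using (_≤±_)
  open ExtremaStrict _<_ public using (_<±_)

  -- An element with property P if there is one, the default d otherwise.
  -- Below, P always determines its element up to equality.
  choose : {X : Set} → X → (X → Set) → X
  choose d P = pick em
    where
    pick : Dec (∃ P) → _
    pick (yes (x , _)) = x
    pick (no _)        = d

  min : {I : Set} → (I → ℝ) → ℝ
  min f = choose 0# λ m → (∃[ i ] m ≈ f i) × (∀ i → m ≤ f i)

  sup± inf± : {I : Set} → (I → ℝ ±) → ℝ ±
  sup± f = choose ⊥± (IsLub _≤±_ f)
  inf± f = choose ⊤± (IsGlb _≤±_ f)

  liminf limsup : (ℝ → ℝ) → ℝ ±
  liminf f = sup± λ T → inf± λ ((t , _) : ∃[ t ] T ≤ t) → [ f t ]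
  limsup f = inf± λ T → sup± λ ((t , _) : ∃[ t ] T ≤ t) → [ f t ]

  √ : ℝ → ℝ
  √ x = choose 0# λ s → 0# ≤ s × s * s ≈ x

  infixr 8 _^ᶻ_ _^ᵠ_ _^ʳ_

  _^ᶻ_ : ℝ → ℤ → ℝ
  t ^ᶻ (+ n)    = t ^ n
  t ^ᶻ -[1+ n ] = (t ^ suc n) ⁻¹

  _^ᵠ_ : ℝ → ℚ → ℝ
  t ^ᵠ q = choose 0# λ s → 0# < s × s ^ (↧ₙ q) ≈ t ^ᶻ (↥ q)

  -- For t ≥ 1, t ^ γ = sup { t ^ q | q rational, q ≤ γ };
  -- for 0 < t < 1, t ^ γ = (1 / t) ^ (- γ).
  _^ʳ_ : ℝ → ℝ → ℝ
  t ^ʳ γ = if does (em {1# ≤ t}) then expand t γ else expand (t ⁻¹) (- γ)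
    where
    expand : ℝ → ℝ → ℝ
    expand b δ =
      choose 0# (IsLub _≤_ λ ((q , _) : ∃[ q ] fromℚ q ≤ δ) → b ^ᵠ q)

  Matrix : Set
  Matrix = Fin 2 → Fin 2 → ℝ

  det : Matrix → ℝ
  det A = A 0F 0F * A 1F 1F - A 0F 1F * A 1F 0F

  Plane : Set
  Plane = ℝ × ℝ

  infix 9 _ℤ²
  _ℤ² : Matrix → Pred Plane 0ℓ
  (A ℤ²) (x₁ , x₂) = ∃₂ λ m n →
      x₁ ≈ A 0F 0F * fromℤ m + A 0F 1F * fromℤ n
    × x₂ ≈ A 1F 0F * fromℤ m + A 1F 1F * fromℤ n

  ‖_‖ : Plane → ℝ
  ‖ x₁ , x₂ ‖ = ∣ x₁ ∣ ⊔ ∣ x₂ ∣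

  -- Meaningful once t is large enough for the index set to be inhabited;
  -- only such t affect the limits below.
  Ψ : Pred Plane 0ℓ → ℝ → ℝ
  Ψ Λ t = min λ (((x₁ , x₂) , _) : ∃[ x ] Λ x × 0# < ‖ x ‖ × ‖ x ‖ ≤ t) →
    √ ∣ x₁ * x₂ ∣

  ω ω̄ : Pred Plane 0ℓ → ℝ ±
  ω Λ = sup± λ ((γ , _) : ∃[ γ ] liminf (λ t → t ^ʳ γ * Ψ Λ t) <± ⊤±) → [ γ ]
  ω̄ Λ = sup± λ ((γ , _) : ∃[ γ ] limsup (λ t → t ^ʳ γ * Ψ Λ t) <± ⊤±) → [ γ ]

  𝒢 : ℝ → ℝ → ℝ
  𝒢 y x = x ^ 2 - (1# + 1#) * y * x - 1#

  𝔊 : ℝ → ℝ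
  𝔊 y = choose 0# λ x → 0# < x × 𝒢 y x ≈ 0#

  -- y ↦ 𝔊 y * y on extended reals.  The exponents are never ⊥±.
  𝔊[_]* : ℝ ± → ℝ ±
  𝔊[ ⊥± ]*    = ⊥±
  𝔊[ [ y ] ]* = [ 𝔊 y * y ]
  𝔊[ ⊤± ]*    = ⊤±

{-# OPTIONS --safe #-}
module Submission where

-- Measure a lattice point v = (v₁ , v₂) by its radius t = max(|v₁|, |v₂|) and
-- by N = |v₁ v₂|, and let v₀, v₁, v₂, … be the successive points at which N
-- attains a new minimum.  A bound N ≤ C t^(-2γ) holding for all large radii,
-- read just before the next radius, gives N(vₖ) ≤ C′ tₖ₊₁^(-2γ).  If N ≥ t^(-2β)
-- for all far points, then in particular tₖ₊₁^γ ≤ C″ tₖ^β.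
--
-- Two of v₀, v₁, v₂ are close to the same coordinate axis.  They are not
-- parallel, so their determinant is at least |det A|, and this forces
-- tᵢ ≤ C tⱼ N(vᵢ) for i < j.  Hence r s^(2γ) ≤ C u for three consecutive
-- radii r ≤ s ≤ u, while u ≤ C s^(β/γ) and s ≤ C r^(β/γ).  Letting s → ∞,
-- γ/β + 2γ ≤ β/γ, that is, β/γ is at least the positive root of x² - 2γx - 1.
--
-- It suffices to take β and γ rational, so that only integer powers of radii
-- have to be compared.

open import Defs
import Algebra.Construct.NaturalChoice.Max as Max
import Algebra.Properties.CommutativeSemigroup as CommutativeSemigroupProperties
import Algebra.Properties.CommutativeSemiring.Exp as Exp
import Algebra.Properties.Ring as RingProperties
import Algebra.Properties.Semiring.Mult as SemiringMult
import Algebra.Properties.Semiring.Mult.TCOptimised as OptimisedMult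
import Algebra.Solver.Ring
open import Algebra.Solver.Ring.AlmostCommutativeRing
  using (fromCommutativeRing; _-Raw-AlmostCommutative⟶_)
open import Axiom.ExcludedMiddle using (ExcludedMiddle)
open import Data.Empty using (⊥)
open import Data.Fin.Patterns using (0F; 1F)
open import Data.Integer.Base as ℤ using (ℤ; +_; -[1+_]; _⊖_)
open import Data.Integer.GCD using (gcd)
import Data.Integer.Properties as ℤ
open import Data.List.Base using (List; _∷_; map; _++_; upTo; cartesianProduct)
open import Data.List.Membership.Propositional using (_∈_)
open import Data.List.Membership.Propositional.Properties
  using (∈-map⁺; ∈-++⁺ˡ; ∈-++⁺ʳ; ∈-upTo⁺; ∈-cartesianProduct⁺)
open import Data.List.Relation.Unary.Any using (here; there)
open import Data.Maybe.Base using (Maybe; just; nothing)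
open import Data.Nat.Base as ℕ using (ℕ; zero; suc)
import Data.Nat.Properties as ℕ
import Data.Nat.Tactic.RingSolver as ℕ-Tactic
open import Data.Product.Base using (Σ; ∃; ∃-syntax; _×_; _,_; proj₁; proj₂)
open import Data.Rational.Base as ℚ using (ℚ; mkℚ; ↥_; ↧_; ↧ₙ_)
import Data.Rational.Properties as ℚ
open import Data.Sum.Base using (_⊎_; inj₁; inj₂; [_,_]′)
open import Data.Unit.Base using (⊤; tt)
open import Function.Base using (_∘_; id)
open import Level using (0ℓ)
open import Relation.Binary.Bundles using (TotalOrder)
import Relation.Binary.Construct.Add.Extrema.NonStrict as ExtremaNonStrict
import Relation.Binary.Construct.Add.Extrema.Strict as ExtremaStrict
import Relation.Binary.Construct.Add.Supremum.NonStrict as AddSupremum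
import Relation.Binary.Construct.NonStrictToStrict as NonStrictToStrict
open import Relation.Binary.PropositionalEquality as ≡ using (_≡_)
import Relation.Binary.Reasoning.PartialOrder as PartialOrderReasoning
open import Relation.Binary.Structures using (IsTotalOrder)
open import Relation.Nullary.Construct.Add.Extrema using (_±; ⊥±; [_]; ⊤±)
open import Relation.Nullary.Decidable.Core using (yes; no)
open import Relation.Nullary.Negation.Core using (¬_; contradiction)

-- Irrationality of θ and η makes both coordinates of a nonzero lattice point nonzero, so N is
-- positive there and has a positive minimum on every ball. The uniform bound with γ > 0 pushes N
-- below every ε, hence the minimal points never stop. No sequence is built: a contradiction is
-- reached on four consecutive minimal points beyond a fixed radius. Three would not do: if the pair
-- near a common axis is the last two of them, r s^(2γ) ≤ C u is obtained for the triple shifted by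
-- one. Cleared of denominators, γ/β + 2γ > β/γ is β² < γ² + 2γ²β. On the other side, z = 𝔊_y y
-- satisfies z² = y² + 2y²z, so the same inequality holds for β below z. Real powers, being suprema
-- of rational powers, are only ever compared with rational ones. Exponents become naturals n, a, c
-- with a/n = 2γ and c/n = 2β; the factor 2 appears because the values of N are those of Ψ² and not
-- of Ψ.

module IntegerEmbedding (R : CompleteOrderedField) where

  open CompleteOrderedField R renaming (Carrier to ℝ)
  open RingProperties ring
  open SemiringMult semiring using (×-homo-+; ×1-homo-*)
  open OptimisedMult semiring using (×ᵤ≈×) renaming (_×_ to _·′_)
  open import Relation.Binary.Reasoning.Setoid setoid

  opaque

    fromℤ-homo‿- : ∀ i → fromℤ (ℤ.- i) ≈ - fromℤ i
    fromℤ-homo‿- (+ zero)  = sym -0#≈0#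
    fromℤ-homo‿- (+ suc n) = refl
    fromℤ-homo‿- -[1+ n ]  = sym (-‿involutive _)

    fromℤ-homo-⊖ : ∀ m n → fromℤ (m ⊖ n) ≈ m · 1# - n · 1#
    fromℤ-homo-⊖ m zero = begin
      m · 1#        ≈⟨ +-identityʳ _ ⟨
      m · 1# + 0#   ≈⟨ +-congˡ -0#≈0# ⟨
      m · 1# - 0#   ∎
    fromℤ-homo-⊖ zero (suc n) = sym (+-identityˡ _)
    fromℤ-homo-⊖ (suc m) (suc n) = begin
      fromℤ (suc m ⊖ suc n)            ≡⟨ ≡.cong fromℤ (ℤ.[1+m]⊖[1+n]≡m⊖n m n) ⟩
      fromℤ (m ⊖ n)                    ≈⟨ fromℤ-homo-⊖ m n ⟩
      m · 1# - n · 1#                  ≈⟨ +-congʳ (+-identityˡ _) ⟨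
      0# + m · 1# - n · 1#             ≈⟨ +-congʳ (+-congʳ (-‿inverseʳ 1#)) ⟨
      1# - 1# + m · 1# - n · 1#        ≈⟨ +-congʳ (+-assoc _ _ _) ⟩
      1# + (- 1# + m · 1#) - n · 1#    ≈⟨ +-congʳ (+-congˡ (+-comm _ _)) ⟩
      1# + (m · 1# - 1#) - n · 1#      ≈⟨ +-congʳ (+-assoc _ _ _) ⟨
      suc m · 1# - 1# - n · 1#         ≈⟨ +-assoc _ _ _ ⟩
      suc m · 1# + (- 1# - n · 1#)     ≈⟨ +-congˡ (-‿+-comm _ _) ⟩
      suc m · 1# - suc n · 1#          ∎

    fromℤ-homo-+ : ∀ i j → fromℤ (i ℤ.+ j) ≈ fromℤ i + fromℤ j
    fromℤ-homo-+ (+ m)    (+ n)    = ×-homo-+ 1# m n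
    fromℤ-homo-+ (+ m)    -[1+ n ] = fromℤ-homo-⊖ m (suc n)
    fromℤ-homo-+ -[1+ m ] (+ n)    = trans (fromℤ-homo-⊖ n (suc m)) (+-comm _ _)
    fromℤ-homo-+ -[1+ m ] -[1+ n ] = begin
      - (suc (suc (m ℕ.+ n)) · 1#)      ≡⟨ ≡.cong (λ k → - (k · 1#)) (ℕ.+-suc (suc m) n) ⟨
      - ((suc m ℕ.+ suc n) · 1#)        ≈⟨ -‿cong (×-homo-+ 1# (suc m) (suc n)) ⟩
      - (suc m · 1# + suc n · 1#)       ≈⟨ -‿+-comm _ _ ⟨
      - (suc m · 1#) - suc n · 1#       ∎

    private
      fromℤ-homo-+* : ∀ m j → fromℤ (+ m ℤ.* j) ≈ m · 1# * fromℤ j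
      fromℤ-homo-+* m (+ n) = begin
        fromℤ (+ m ℤ.* + n)   ≡⟨ ≡.cong fromℤ (ℤ.pos-* m n) ⟨
        (m ℕ.* n) · 1#        ≈⟨ ×1-homo-* m n ⟩
        m · 1# * n · 1#       ∎
      fromℤ-homo-+* m -[1+ n ] = begin
        fromℤ (+ m ℤ.* (ℤ.- + suc n))   ≡⟨ ≡.cong fromℤ (ℤ.neg-distribʳ-* (+ m) (+ suc n)) ⟨
        fromℤ (ℤ.- (+ m ℤ.* + suc n))   ≈⟨ fromℤ-homo‿- (+ m ℤ.* + suc n) ⟩
        - fromℤ (+ m ℤ.* + suc n)       ≈⟨ -‿cong (fromℤ-homo-+* m (+ suc n)) ⟩
        - (m · 1# * suc n · 1#)         ≈⟨ -‿distribʳ-* _ _ ⟩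
        m · 1# * - (suc n · 1#)         ∎

    fromℤ-homo-* : ∀ i j → fromℤ (i ℤ.* j) ≈ fromℤ i * fromℤ j
    fromℤ-homo-* (+ m) j = fromℤ-homo-+* m j
    fromℤ-homo-* -[1+ m ] j = begin
      fromℤ ((ℤ.- + suc m) ℤ.* j)   ≡⟨ ≡.cong fromℤ (ℤ.neg-distribˡ-* (+ suc m) j) ⟨
      fromℤ (ℤ.- (+ suc m ℤ.* j))   ≈⟨ fromℤ-homo‿- (+ suc m ℤ.* j) ⟩
      - fromℤ (+ suc m ℤ.* j)       ≈⟨ -‿cong (fromℤ-homo-+* (suc m) j) ⟩
      - (suc m · 1# * fromℤ j)      ≈⟨ -‿distribˡ-* _ _ ⟩
      - (suc m · 1#) * fromℤ j      ∎

  -- Agrees with fromℤ, but sends + 1 to 1# definitionally, so that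
  -- solver constants read as the expressions they stand for.
  private
    coeff : ℤ → ℝ
    coeff (+ n)    = n ·′ 1#
    coeff -[1+ n ] = - (suc n ·′ 1#)

    fromℤ≈coeff : ∀ i → fromℤ i ≈ coeff i
    fromℤ≈coeff (+ n)    = ×ᵤ≈× n 1#
    fromℤ≈coeff -[1+ n ] = -‿cong (×ᵤ≈× (suc n) 1#)

    coeff-morphism : ℤ.+-*-rawRing -Raw-AlmostCommutative⟶ fromCommutativeRing commutativeRing
    coeff-morphism = record
      { ⟦_⟧    = coeff
      ; +-homo = λ i j → trans (sym (fromℤ≈coeff (i ℤ.+ j)))
          (trans (fromℤ-homo-+ i j) (+-cong (fromℤ≈coeff i) (fromℤ≈coeff j)))
      ; *-homo = λ i j → trans (sym (fromℤ≈coeff (i ℤ.* j)))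
          (trans (fromℤ-homo-* i j) (*-cong (fromℤ≈coeff i) (fromℤ≈coeff j)))
      ; -‿homo = λ i → trans (sym (fromℤ≈coeff (ℤ.- i)))
          (trans (fromℤ-homo‿- i) (-‿cong (fromℤ≈coeff i)))
      ; 0-homo = refl
      ; 1-homo = refl
      }

    coeff≟ : ∀ i j → Maybe (coeff i ≈ coeff j)
    coeff≟ i j with i ℤ.≟ j
    ... | yes ≡.refl = just refl
    ... | no _       = nothing

  module Solver = Algebra.Solver.Ring
    ℤ.+-*-rawRing (fromCommutativeRing commutativeRing) coeff-morphism coeff≟

-- Reduction divides `i` and `n` by their gcd; multiplying the reduced terms by it recovers both,
-- and the cross product does not see the common factor.
↥/*n≡↧/*i : ∀ i n .{{_ : ℕ.NonZero n}} → ↥ (i ℚ./ n) ℤ.* + n ≡ ↧ (i ℚ./ n) ℤ.* i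
↥/*n≡↧/*i i n = begin
  ↥ (i ℚ./ n) ℤ.* + n                              ≡⟨ ≡.cong (↥ (i ℚ./ n) ℤ.*_) (ℚ.↧-/ i n) ⟨
  ↥ (i ℚ./ n) ℤ.* (↧ (i ℚ./ n) ℤ.* gcd i (+ n))    ≡⟨ x∙yz≈y∙xz (↥ (i ℚ./ n)) (↧ (i ℚ./ n)) (gcd i (+ n)) ⟩
  ↧ (i ℚ./ n) ℤ.* (↥ (i ℚ./ n) ℤ.* gcd i (+ n))    ≡⟨ ≡.cong (↧ (i ℚ./ n) ℤ.*_) (ℚ.↥-/ i n) ⟩
  ↧ (i ℚ./ n) ℤ.* i                                ∎
  where
  open ≡.≡-Reasoning
  open CommutativeSemigroupProperties ℤ.*-commutativeSemigroup using (x∙yz≈y∙xz)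

-- Arithmetic of a complete ordered field

module OrderedField (em : ExcludedMiddle 0ℓ) (R : CompleteOrderedField) where

  open CompleteOrderedField R hiding (zero) renaming (Carrier to ℝ)
  open IntegerEmbedding R
  open IsTotalOrder isTotalOrder public
    using (total; antisym; ≤-respˡ-≈; ≤-respʳ-≈)
    renaming (refl to ≤-refl; reflexive to ≤-reflexive; trans to ≤-trans)
  open TotalOrder totalOrder using (poset)
  open Max totalOrder public
    using (⊔-cong; ⊔-sel; ⊔-lub; x≤x⊔y; x≤y⊔x; x≤y⇒x⊔y≈y; x≤y⇒y⊔x≈y)
  open Exp commutativeSemiring public
    using (^-congˡ; ^-congʳ; ^-homo-*; ^-assocʳ; ^-distrib-*)
  open SemiringMult semiring public
    using () renaming (×-homo-+ to ·-homo-+; ×1-homo-* to ·1-homo-*)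
  open Solver using (solve; _:+_; _:*_; _:-_; :-_; con; _:=_)
  open PartialOrderReasoning poset

  opaque

    ≰⇒> : ∀ {x y} → ¬ x ≤ y → y < x
    ≰⇒> = NonStrictToStrict.≰⇒> _≈_ _≤_ sym ≤-reflexive total

    <⇒≱ : ∀ {x y} → x < y → ¬ y ≤ x
    <⇒≱ = NonStrictToStrict.<⇒≱ _≈_ _≤_ antisym

    ≤⇒≯ : ∀ {x y} → x ≤ y → ¬ y < x
    ≤⇒≯ = NonStrictToStrict.≤⇒≯ _≈_ _≤_ antisym

    ≤-<-trans : ∀ {x y z} → x ≤ y → y < z → x < z
    ≤-<-trans = NonStrictToStrict.≤-<-trans _≈_ _≤_ ≤-trans antisym ≤-respˡ-≈

    <-≤-trans : ∀ {x y z} → x < y → y ≤ z → x < z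
    <-≤-trans = NonStrictToStrict.<-≤-trans _≈_ _≤_ sym ≤-trans antisym ≤-respʳ-≈

    ≤-<-total : ∀ x y → x ≤ y ⊎ y < x
    ≤-<-total x y with em {x ≤ y}
    ... | yes x≤y = inj₁ x≤y
    ... | no  x≰y = inj₂ (≰⇒> x≰y)

    ¬¬-elim : ∀ {P : Set} → ¬ ¬ P → P
    ¬¬-elim {P} ¬¬P with em {P}
    ... | yes P-true = P-true
    ... | no ¬P      = contradiction ¬P ¬¬P

    ≮⇒≥ : ∀ {x y} → ¬ x < y → y ≤ x
    ≮⇒≥ {x} {y} x≮y = [ id , (λ x<y → contradiction x<y x≮y) ]′ (≤-<-total y x)

    +-monoˡ-≤ : ∀ z {x y} → x ≤ y → x + z ≤ y + z
    +-monoˡ-≤ z {x} {y} x≤y = begin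
      x + z  ≈⟨ +-comm x z ⟩
      z + x  ≤⟨ +-monoʳ-≤ z x≤y ⟩
      z + y  ≈⟨ +-comm z y ⟩
      y + z  ∎

    +-mono-≤ : ∀ {x y z w} → x ≤ y → z ≤ w → x + z ≤ y + w
    +-mono-≤ x≤y z≤w = ≤-trans (+-monoˡ-≤ _ x≤y) (+-monoʳ-≤ _ z≤w)

    +-cancelˡ-≤ : ∀ z {x y} → z + x ≤ z + y → x ≤ y
    +-cancelˡ-≤ z {x} {y} zx≤zy = begin
      x              ≈⟨ solve 2 (λ z x → x := :- z :+ (z :+ x)) refl z x ⟩
      - z + (z + x)  ≤⟨ +-monoʳ-≤ (- z) zx≤zy ⟩
      - z + (z + y)  ≈⟨ solve 2 (λ z x → x := :- z :+ (z :+ x)) refl z y ⟨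
      y              ∎

    +-monoʳ-< : ∀ z {x y} → x < y → z + x < z + y
    +-monoʳ-< z x<y = ≰⇒> (<⇒≱ x<y ∘ +-cancelˡ-≤ z)

    x≤y⇒0≤y-x : ∀ {x y} → x ≤ y → 0# ≤ y - x
    x≤y⇒0≤y-x {x} {y} x≤y = begin
      0#     ≈⟨ -‿inverseʳ x ⟨
      x - x  ≤⟨ +-monoˡ-≤ (- x) x≤y ⟩
      y - x  ∎

    0≤y-x⇒x≤y : ∀ {x y} → 0# ≤ y - x → x ≤ y
    0≤y-x⇒x≤y {x} {y} 0≤y-x = begin
      x            ≈⟨ +-identityʳ x ⟨
      x + 0#       ≤⟨ +-monoʳ-≤ x 0≤y-x ⟩
      x + (y - x)  ≈⟨ solve 2 (λ x y → x :+ (y :- x) := y) refl x y ⟩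
      y            ∎

    x<y⇒0<y-x : ∀ {x y} → x < y → 0# < y - x
    x<y⇒0<y-x x<y = ≰⇒> λ y-x≤0 → <⇒≱ x<y (0≤y-x⇒x≤y (begin
      0#            ≤⟨ x≤y⇒0≤y-x y-x≤0 ⟩
      0# - (_ - _)  ≈⟨ solve 2 (λ x y → con (+ 0) :- (y :- x) := x :- y) refl _ _ ⟩
      _ - _         ∎))

    x<x+y : ∀ x {y} → 0# < y → x < x + y
    x<x+y x {y} 0<y = begin-strict
      x       ≈⟨ +-identityʳ x ⟨
      x + 0#  <⟨ +-monoʳ-< x 0<y ⟩
      x + y   ∎

    x-y<x : ∀ x {y} → 0# < y → x - y < x
    x-y<x x {y} 0<y = begin-strict
      x - y      <⟨ x<x+y (x - y) 0<y ⟩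
      x - y + y  ≈⟨ solve 2 (λ x y → x :- y :+ y := x) refl x y ⟩
      x          ∎

    neg-mono-≤ : ∀ {x y} → x ≤ y → - y ≤ - x
    neg-mono-≤ {x} {y} x≤y = 0≤y-x⇒x≤y (begin
      0#         ≤⟨ x≤y⇒0≤y-x x≤y ⟩
      y - x      ≈⟨ solve 2 (λ x y → y :- x := :- x :- :- y) refl x y ⟩
      - x - - y  ∎)

    x≤0⇒0≤-x : ∀ {x} → x ≤ 0# → 0# ≤ - x
    x≤0⇒0≤-x {x} x≤0 = begin
      0#      ≤⟨ x≤y⇒0≤y-x x≤0 ⟩
      0# - x  ≈⟨ +-identityˡ (- x) ⟩
      - x     ∎

    *-monoʳ-≤ : ∀ {z x y} → 0# ≤ z → x ≤ y → z * x ≤ z * y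
    *-monoʳ-≤ {z} {x} {y} 0≤z x≤y = 0≤y-x⇒x≤y (begin
      0#             ≤⟨ *-nonNeg 0≤z (x≤y⇒0≤y-x x≤y) ⟩
      z * (y - x)    ≈⟨ solve 3 (λ z x y → z :* (y :- x) := z :* y :- z :* x) refl z x y ⟩
      z * y - z * x  ∎)

    *-monoˡ-≤ : ∀ {z x y} → 0# ≤ z → x ≤ y → x * z ≤ y * z
    *-monoˡ-≤ {z} {x} {y} 0≤z x≤y = begin
      x * z  ≈⟨ *-comm x z ⟩
      z * x  ≤⟨ *-monoʳ-≤ 0≤z x≤y ⟩
      z * y  ≈⟨ *-comm z y ⟩
      y * z  ∎

    *-mono-≤ : ∀ {x y z w} → 0# ≤ x → 0# ≤ w → x ≤ y → z ≤ w → x * z ≤ y * w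
    *-mono-≤ 0≤x 0≤w x≤y z≤w = ≤-trans (*-monoʳ-≤ 0≤x z≤w) (*-monoˡ-≤ 0≤w x≤y)

    0≤1 : 0# ≤ 1#
    0≤1 with total 0# 1#
    ... | inj₁ 0≤1 = 0≤1
    ... | inj₂ 1≤0 = begin
      0#           ≤⟨ *-nonNeg (x≤0⇒0≤-x 1≤0) (x≤0⇒0≤-x 1≤0) ⟩
      - 1# * - 1#  ≈⟨ solve 0 (:- con (+ 1) :* :- con (+ 1) := con (+ 1)) refl ⟩
      1#           ∎

    0<1 : 0# < 1#
    0<1 = 0≤1 , 0≉1

    pos⇒≉0 : ∀ {x} → 0# < x → x ≉ 0#
    pos⇒≉0 (_ , 0≉x) = 0≉x ∘ sym

    ⁻¹-inverseˡ : ∀ x → x ≉ 0# → x ⁻¹ * x ≈ 1#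
    ⁻¹-inverseˡ x x≉0 = trans (*-comm _ _) (⁻¹-inverseʳ x x≉0)

    *-cancelˡ-≈ : ∀ {x y z} → x ≉ 0# → x * y ≈ x * z → y ≈ z
    *-cancelˡ-≈ {x} {y} {z} x≉0 xy≈xz = begin-equality
      y               ≈⟨ expand y ⟩
      x ⁻¹ * (x * y)  ≈⟨ *-congˡ xy≈xz ⟩
      x ⁻¹ * (x * z)  ≈⟨ expand z ⟨
      z               ∎
      where
      expand : ∀ w → w ≈ x ⁻¹ * (x * w)
      expand w = begin-equality
        w               ≈⟨ *-identityˡ w ⟨
        1# * w          ≈⟨ *-congʳ (⁻¹-inverseˡ x x≉0) ⟨
        x ⁻¹ * x * w    ≈⟨ *-assoc _ _ _ ⟩
        x ⁻¹ * (x * w)  ∎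

    *-≉0 : ∀ {x y} → x ≉ 0# → y ≉ 0# → x * y ≉ 0#
    *-≉0 x≉0 y≉0 xy≈0 = y≉0 (*-cancelˡ-≈ x≉0 (trans xy≈0 (sym (zeroʳ _))))

    *-pos : ∀ {x y} → 0# < x → 0# < y → 0# < x * y
    *-pos 0<x 0<y = *-nonNeg (proj₁ 0<x) (proj₁ 0<y) , *-≉0 (pos⇒≉0 0<x) (pos⇒≉0 0<y) ∘ sym

    *-cancelˡ-≤ : ∀ {x y z} → 0# < x → x * y ≤ x * z → y ≤ z
    *-cancelˡ-≤ {x} {y} {z} 0<x xy≤xz with total y z
    ... | inj₁ y≤z = y≤z
    ... | inj₂ z≤y = ≤-reflexive (*-cancelˡ-≈ (pos⇒≉0 0<x) (antisym xy≤xz (*-monoʳ-≤ (proj₁ 0<x) z≤y)))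

    *-monoʳ-< : ∀ {z x y} → 0# < z → x < y → z * x < z * y
    *-monoʳ-< 0<z x<y = ≰⇒> (<⇒≱ x<y ∘ *-cancelˡ-≤ 0<z)

    *-monoˡ-< : ∀ {z x y} → 0# < z → x < y → x * z < y * z
    *-monoˡ-< {z} {x} {y} 0<z x<y = begin-strict
      x * z  ≈⟨ *-comm x z ⟩
      z * x  <⟨ *-monoʳ-< 0<z x<y ⟩
      z * y  ≈⟨ *-comm z y ⟩
      y * z  ∎

    *-cancelʳ-< : ∀ {z x y} → 0# ≤ z → x * z < y * z → x < y
    *-cancelʳ-< 0≤z xz<yz = ≰⇒> (<⇒≱ xz<yz ∘ *-monoˡ-≤ 0≤z)

    ⁻¹-pos : ∀ {x} → 0# < x → 0# < x ⁻¹
    ⁻¹-pos {x} 0<x = ≰⇒> λ x⁻¹≤0 → <⇒≱ 0<1 (begin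
      1#        ≈⟨ ⁻¹-inverseʳ x (pos⇒≉0 0<x) ⟨
      x * x ⁻¹  ≤⟨ *-monoʳ-≤ (proj₁ 0<x) x⁻¹≤0 ⟩
      x * 0#    ≈⟨ zeroʳ x ⟩
      0#        ∎)

    x/y*y≈x : ∀ x {y} → y ≉ 0# → x / y * y ≈ x
    x/y*y≈x x {y} y≉0 = begin-equality
      x * y ⁻¹ * y    ≈⟨ *-assoc x _ y ⟩
      x * (y ⁻¹ * y)  ≈⟨ *-congˡ (⁻¹-inverseˡ y y≉0) ⟩
      x * 1#          ≈⟨ *-identityʳ x ⟩
      x               ∎

    /-pos : ∀ {x y} → 0# < x → 0# < y → 0# < x / y
    /-pos 0<x 0<y = *-pos 0<x (⁻¹-pos 0<y)

  -- Absolute values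

  opaque

    0≤x⇒∣x∣≈x : ∀ {x} → 0# ≤ x → ∣ x ∣ ≈ x
    0≤x⇒∣x∣≈x {x} 0≤x = x≤y⇒y⊔x≈y (begin
      - x   ≤⟨ neg-mono-≤ 0≤x ⟩
      - 0#  ≈⟨ solve 0 (:- con (+ 0) := con (+ 0)) refl ⟩
      0#    ≤⟨ 0≤x ⟩
      x     ∎)

    x≤0⇒∣x∣≈-x : ∀ {x} → x ≤ 0# → ∣ x ∣ ≈ - x
    x≤0⇒∣x∣≈-x x≤0 = x≤y⇒x⊔y≈y (≤-trans x≤0 (x≤0⇒0≤-x x≤0))

    0≤∣x∣ : ∀ x → 0# ≤ ∣ x ∣
    0≤∣x∣ x with total 0# x
    ... | inj₁ 0≤x = ≤-trans 0≤x (x≤x⊔y x (- x))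
    ... | inj₂ x≤0 = ≤-trans (x≤0⇒0≤-x x≤0) (x≤y⊔x x (- x))

    ∣x∣≈x⊎-x : ∀ x → ∣ x ∣ ≈ x ⊎ ∣ x ∣ ≈ - x
    ∣x∣≈x⊎-x x = ⊔-sel x (- x)

    ∣∣-cong : ∀ {x y} → x ≈ y → ∣ x ∣ ≈ ∣ y ∣
    ∣∣-cong x≈y = ⊔-cong x≈y (-‿cong x≈y)

    ∣∣-unique : ∀ {x y} → 0# ≤ y → y ≈ x ⊎ y ≈ - x → ∣ x ∣ ≈ y
    ∣∣-unique 0≤y (inj₁ y≈x) = trans (∣∣-cong (sym y≈x)) (0≤x⇒∣x∣≈x 0≤y)
    ∣∣-unique {x} {y} 0≤y (inj₂ y≈-x) = trans (x≤0⇒∣x∣≈-x (begin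
      x      ≈⟨ solve 1 (λ x → x := :- :- x) refl x ⟩
      - - x  ≈⟨ -‿cong y≈-x ⟨
      - y    ≤⟨ neg-mono-≤ 0≤y ⟩
      - 0#   ≈⟨ solve 0 (:- con (+ 0) := con (+ 0)) refl ⟩
      0#     ∎)) (sym y≈-x)

    ∣x*y∣≈∣x∣*∣y∣ : ∀ x y → ∣ x * y ∣ ≈ ∣ x ∣ * ∣ y ∣
    ∣x*y∣≈∣x∣*∣y∣ x y = ∣∣-unique (*-nonNeg (0≤∣x∣ x) (0≤∣x∣ y)) (signs (∣x∣≈x⊎-x x) (∣x∣≈x⊎-x y))
      where
      signs : ∣ x ∣ ≈ x ⊎ ∣ x ∣ ≈ - x → ∣ y ∣ ≈ y ⊎ ∣ y ∣ ≈ - y →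
              ∣ x ∣ * ∣ y ∣ ≈ x * y ⊎ ∣ x ∣ * ∣ y ∣ ≈ - (x * y)
      signs (inj₁ p) (inj₁ q) = inj₁ (*-cong p q)
      signs (inj₁ p) (inj₂ q) = inj₂ (trans (*-cong p q)
        (solve 2 (λ x y → x :* :- y := :- (x :* y)) refl x y))
      signs (inj₂ p) (inj₁ q) = inj₂ (trans (*-cong p q)
        (solve 2 (λ x y → :- x :* y := :- (x :* y)) refl x y))
      signs (inj₂ p) (inj₂ q) = inj₁ (trans (*-cong p q)
        (solve 2 (λ x y → :- x :* :- y := x :* y) refl x y))

    ∣x-y∣≤∣x∣+∣y∣ : ∀ x y → ∣ x - y ∣ ≤ ∣ x ∣ + ∣ y ∣
    ∣x-y∣≤∣x∣+∣y∣ x y = ⊔-lub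
      (+-mono-≤ (x≤x⊔y x (- x)) (x≤y⊔x y (- y)))
      (begin
        - (x - y)      ≈⟨ solve 2 (λ x y → :- (x :- y) := :- x :+ y) refl x y ⟩
        - x + y        ≤⟨ +-mono-≤ (x≤y⊔x x (- x)) (x≤x⊔y y (- y)) ⟩
        ∣ x ∣ + ∣ y ∣  ∎)

    x≉0⇒0<∣x∣ : ∀ {x} → x ≉ 0# → 0# < ∣ x ∣
    x≉0⇒0<∣x∣ {x} x≉0 = 0≤∣x∣ x , λ 0≈∣x∣ → x≉0 (vanish 0≈∣x∣ (∣x∣≈x⊎-x x))
      where
      vanish : 0# ≈ ∣ x ∣ → ∣ x ∣ ≈ x ⊎ ∣ x ∣ ≈ - x → x ≈ 0#
      vanish 0≈∣x∣ (inj₁ p) = sym (trans 0≈∣x∣ p)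
      vanish 0≈∣x∣ (inj₂ p) = begin-equality
        x      ≈⟨ solve 1 (λ x → x := :- :- x) refl x ⟩
        - - x  ≈⟨ -‿cong (trans 0≈∣x∣ p) ⟨
        - 0#   ≈⟨ solve 0 (:- con (+ 0) := con (+ 0)) refl ⟩
        0#     ∎

  -- Powers

  opaque

    ^-pos : ∀ {x} → 0# < x → ∀ n → 0# < x ^ n
    ^-pos 0<x zero    = 0<1
    ^-pos 0<x (suc n) = *-pos 0<x (^-pos 0<x n)

    ^-nonNeg : ∀ {x} → 0# ≤ x → ∀ n → 0# ≤ x ^ n
    ^-nonNeg 0≤x zero    = 0≤1
    ^-nonNeg 0≤x (suc n) = *-nonNeg 0≤x (^-nonNeg 0≤x n)

    ^-mono-≤ : ∀ n {x y} → 0# ≤ x → x ≤ y → x ^ n ≤ y ^ n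
    ^-mono-≤ zero    0≤x x≤y = ≤-refl
    ^-mono-≤ (suc n) 0≤x x≤y =
      *-mono-≤ 0≤x (^-nonNeg (≤-trans 0≤x x≤y) n) x≤y (^-mono-≤ n 0≤x x≤y)

    ^-mono-< : ∀ n {x y} → 0# ≤ x → x < y → x ^ suc n < y ^ suc n
    ^-mono-< n {x} {y} 0≤x x<y = begin-strict
      x * x ^ n  ≤⟨ *-monoʳ-≤ 0≤x (^-mono-≤ n 0≤x (proj₁ x<y)) ⟩
      x * y ^ n  <⟨ *-monoˡ-< (^-pos (≤-<-trans 0≤x x<y) n) x<y ⟩
      y * y ^ n  ∎

    ^-cancel-≤ : ∀ n {x y} → 0# ≤ y → x ^ suc n ≤ y ^ suc n → x ≤ y
    ^-cancel-≤ n 0≤y xⁿ≤yⁿ = ≮⇒≥ λ y<x → <⇒≱ (^-mono-< n 0≤y y<x) xⁿ≤yⁿ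

    1^n≈1 : ∀ n → 1# ^ n ≈ 1#
    1^n≈1 zero    = refl
    1^n≈1 (suc n) = trans (*-identityˡ _) (1^n≈1 n)

    1≤x⇒1≤x^n : ∀ n {x} → 1# ≤ x → 1# ≤ x ^ n
    1≤x⇒1≤x^n n {x} 1≤x = begin
      1#      ≈⟨ 1^n≈1 n ⟨
      1# ^ n  ≤⟨ ^-mono-≤ n 0≤1 1≤x ⟩
      x ^ n   ∎

    ^-monoʳ-≤ : ∀ {x} → 1# ≤ x → ∀ {m n} → m ℕ.≤ n → x ^ m ≤ x ^ n
    ^-monoʳ-≤ {x} 1≤x {m} {n} m≤n = begin
      x ^ m                  ≈⟨ *-identityʳ _ ⟨
      x ^ m * 1#             ≤⟨ *-monoʳ-≤ (^-nonNeg 0≤x m) (1≤x⇒1≤x^n (n ℕ.∸ m) 1≤x) ⟩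
      x ^ m * x ^ (n ℕ.∸ m)  ≈⟨ ^-homo-* x m (n ℕ.∸ m) ⟨
      x ^ (m ℕ.+ (n ℕ.∸ m))  ≡⟨ ≡.cong (x ^_) (ℕ.m+[n∸m]≡n m≤n) ⟩
      x ^ n                  ∎
      where
      0≤x : 0# ≤ x
      0≤x = ≤-trans 0≤1 1≤x

  -- Integers and rationals

  opaque

    0≤n·1 : ∀ n → 0# ≤ n · 1#
    0≤n·1 zero    = ≤-refl
    0≤n·1 (suc n) = begin
      0#           ≈⟨ +-identityˡ 0# ⟨
      0# + 0#      ≤⟨ +-mono-≤ 0≤1 (0≤n·1 n) ⟩
      1# + n · 1#  ∎

    n·1<[1+n]·1 : ∀ n → n · 1# < suc n · 1#
    n·1<[1+n]·1 n = begin-strict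
      n · 1#       ≈⟨ +-identityʳ _ ⟨
      n · 1# + 0#  <⟨ +-monoʳ-< (n · 1#) 0<1 ⟩
      n · 1# + 1#  ≈⟨ +-comm _ _ ⟩
      suc n · 1#   ∎

    0<[1+n]·1 : ∀ n → 0# < suc n · 1#
    0<[1+n]·1 n = ≤-<-trans (0≤n·1 n) (n·1<[1+n]·1 n)

    ·1-mono-≤ : ∀ {m n} → m ℕ.≤ n → m · 1# ≤ n · 1#
    ·1-mono-≤ {n = n} ℕ.z≤n = 0≤n·1 n
    ·1-mono-≤ (ℕ.s≤s m≤n)   = +-monoʳ-≤ 1# (·1-mono-≤ m≤n)

    ·1-cancel-< : ∀ {m n} → m · 1# < n · 1# → m ℕ.< n
    ·1-cancel-< m<n = ℕ.≰⇒> λ n≤m → <⇒≱ m<n (·1-mono-≤ n≤m)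

    ·1-cancel-≤ : ∀ {m n} → m · 1# ≤ n · 1# → m ℕ.≤ n
    ·1-cancel-≤ {m} {n} m≤n = ℕ.≮⇒≥ λ n<m → <⇒≱ (n·1<[1+n]·1 n) (≤-trans (·1-mono-≤ n<m) m≤n)

    -- If the naturals were bounded, their supremum lowered by `1#` would still be an upper bound,
    -- because every natural has a successor.
    archimedean : ∀ x → ∃[ n ] x < n · 1#
    archimedean x with em {∃[ n ] x < n · 1#}
    ... | yes ∃n = ∃n
    ... | no  ∄n with complete (_· 1#) 0 (x , λ n → ≮⇒≥ λ x<n → ∄n (n , x<n))
    ...   | s , n≤s , least = contradiction (least (s - 1#) n≤s-1) (<⇒≱ s-1<s)
      where
      n≤s-1 : ∀ n → n · 1# ≤ s - 1#
      n≤s-1 n = begin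
        n · 1#            ≈⟨ solve 1 (λ x → x := con (+ 1) :+ x :- con (+ 1)) refl _ ⟩
        suc n · 1# - 1#   ≤⟨ +-monoˡ-≤ (- 1#) (n≤s (suc n)) ⟩
        s - 1#            ∎
      s-1<s : s - 1# < s
      s-1<s = begin-strict
        s - 1#       ≈⟨ +-identityʳ _ ⟨
        s - 1# + 0#  <⟨ +-monoʳ-< (s - 1#) 0<1 ⟩
        s - 1# + 1#  ≈⟨ solve 1 (λ s → s :- con (+ 1) :+ con (+ 1) := s) refl s ⟩
        s            ∎

    -- Discreteness of the integers; it keeps the determinant of two non-parallel lattice points
    -- away from zero.
    1≤∣fromℤ∣ : ∀ i → i ≡ + 0 ⊎ 1# ≤ ∣ fromℤ i ∣
    1≤∣fromℤ∣ (+ zero)  = inj₁ ≡.refl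
    1≤∣fromℤ∣ (+ suc n) = inj₂ (≤-trans (1≤suc n) (x≤x⊔y _ _))
      where
      1≤suc : ∀ n → 1# ≤ suc n · 1#
      1≤suc n = ≤-trans (≤-reflexive (sym (+-identityʳ 1#))) (·1-mono-≤ (ℕ.s≤s (ℕ.z≤n {n})))
    1≤∣fromℤ∣ -[1+ n ] with 1≤∣fromℤ∣ (+ suc n)
    ... | inj₂ 1≤ = inj₂ (≤-trans 1≤ (≤-reflexive (sym ∣-∣)))
      where
      ∣-∣ : ∣ fromℤ -[1+ n ] ∣ ≈ ∣ fromℤ (+ suc n) ∣
      ∣-∣ = ∣∣-unique (0≤∣x∣ _)
        (inj₂ (trans (0≤x⇒∣x∣≈x (0≤n·1 (suc n))) (solve 1 (λ x → x := :- :- x) refl _)))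

    ↧≉0 : ∀ q → ↧ₙ q · 1# ≉ 0#
    ↧≉0 (mkℚ _ d-1 _) = pos⇒≉0 (0<[1+n]·1 d-1)

    0<↧ : ∀ q → 0# < ↧ₙ q · 1#
    0<↧ (mkℚ _ d-1 _) = 0<[1+n]·1 d-1

    fromℚ*↧≈↥ : ∀ q → fromℚ q * ↧ₙ q · 1# ≈ fromℤ (↥ q)
    fromℚ*↧≈↥ q = x/y*y≈x (fromℤ (↥ q)) (↧≉0 q)

  opaque

    fraction : ∀ i n .{{_ : ℕ.NonZero n}} → ∃[ q ] fromℚ q * n · 1# ≈ fromℤ i
    fraction i n = i ℚ./ n , *-cancelˡ-≈ (↧≉0 (i ℚ./ n)) (cross (i ℚ./ n) (↥/*n≡↧/*i i n))
      where
      cross : ∀ q → ↥ q ℤ.* + n ≡ ↧ q ℤ.* i →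
              ↧ₙ q · 1# * (fromℚ q * n · 1#) ≈ ↧ₙ q · 1# * fromℤ i
      cross q ↥q*n≡↧q*i = begin-equality
        ↧ₙ q · 1# * (fromℚ q * n · 1#)   ≈⟨ solve 3 (λ d q n → d :* (q :* n) := q :* d :* n) refl _ _ _ ⟩
        fromℚ q * ↧ₙ q · 1# * n · 1#     ≈⟨ *-congʳ (fromℚ*↧≈↥ q) ⟩
        fromℤ (↥ q) * n · 1#             ≈⟨ fromℤ-homo-* (↥ q) (+ n) ⟨
        fromℤ (↥ q ℤ.* + n)              ≡⟨ ≡.cong fromℤ ↥q*n≡↧q*i ⟩
        fromℤ (↧ q ℤ.* i)              ≈⟨ fromℤ-homo-* (↧ q) i ⟩
        ↧ₙ q · 1# * fromℤ i              ∎

    nonNeg⇒↥≡+ : ∀ q → 0# ≤ fromℚ q → ∃[ k ] ↥ q ≡ + k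
    nonNeg⇒↥≡+ (mkℚ (+ k) _ _) _ = k , ≡.refl
    nonNeg⇒↥≡+ q@(mkℚ -[1+ k ] d-1 _) 0≤q = contradiction (begin
      0#                            ≤⟨ *-nonNeg 0≤q (0≤n·1 (suc d-1)) ⟩
      fromℚ q * suc d-1 · 1#        ≈⟨ fromℚ*↧≈↥ q ⟩
      - (suc k · 1#)                ∎)
      (<⇒≱ (begin-strict
        - (suc k · 1#)                       ≈⟨ +-identityʳ _ ⟨
        - (suc k · 1#) + 0#                  <⟨ +-monoʳ-< _ (0<[1+n]·1 k) ⟩
        - (suc k · 1#) + suc k · 1#          ≈⟨ -‿inverseˡ _ ⟩
        0#                                   ∎))

  opaque

    least : ∀ (P : ℕ → Set) m → P m → ∃[ k ] P k × (∀ {j} → j ℕ.< k → ¬ P j)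
    least P zero    Pm = zero , Pm , λ ()
    least P (suc m) Pm with em {P zero}
    ... | yes P0 = zero , P0 , λ ()
    ... | no ¬P0 with least (P ∘ suc) m Pm
    ...   | k , Pk , ¬P = suc k , Pk , below
      where
      below : ∀ {j} → j ℕ.< suc k → ¬ P j
      below {zero}  _           = ¬P0
      below {suc j} (ℕ.s≤s j<k) = ¬P j<k

  opaque

    -- Steps of length 1/n below `y - x` cannot jump over the interval, so the least m with m/n
    -- above `x` works. As `x` is nonnegative, m can be sought among the naturals and is a
    -- successor.
    ℚ-dense : ∀ {x y} → 0# ≤ x → x < y → ∃[ q ] x < fromℚ q × fromℚ q < y
    ℚ-dense {x} {y} 0≤x x<y
      with archimedean ((y - x) ⁻¹)
    ... | zero , <0 = contradiction (proj₁ <0) (<⇒≱ (⁻¹-pos (x<y⇒0<y-x x<y)))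
    ... | n@(suc _) , 1/δ<n
      with archimedean (x * n · 1#)
    ... | M , xn<M with least (λ m → x * n · 1# < m · 1#) M xn<M
    ...   | zero , xn<0 , _ = contradiction (*-nonNeg 0≤x (0≤n·1 n)) (<⇒≱ xn<0)
    ...   | suc m , xn<m , ≮m with fraction (+ suc m) n
    ...     | q , qn≈m = q , *-cancelʳ-< (0≤n·1 n) lower , *-cancelʳ-< (0≤n·1 n) upper
      where
      lower : x * n · 1# < fromℚ q * n · 1#
      lower = begin-strict
        x * n · 1#          <⟨ xn<m ⟩
        suc m · 1#          ≈⟨ qn≈m ⟨
        fromℚ q * n · 1#    ∎
      1<δn : 1# < (y - x) * n · 1#
      1<δn = begin-strict
        1#                     ≈⟨ ⁻¹-inverseʳ _ (pos⇒≉0 (x<y⇒0<y-x x<y)) ⟨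
        (y - x) * (y - x) ⁻¹   <⟨ *-monoʳ-< (x<y⇒0<y-x x<y) 1/δ<n ⟩
        (y - x) * n · 1#       ∎
      upper : fromℚ q * n · 1# < y * n · 1#
      upper = begin-strict
        fromℚ q * n · 1#                ≈⟨ qn≈m ⟩
        1# + m · 1#                     ≤⟨ +-monoʳ-≤ 1# (≮⇒≥ (≮m (ℕ.n<1+n m))) ⟩
        1# + x * n · 1#                 ≈⟨ +-comm _ _ ⟩
        x * n · 1# + 1#                 <⟨ +-monoʳ-< _ 1<δn ⟩
        x * n · 1# + (y - x) * n · 1#   ≈⟨ solve 3 (λ x y n → x :* n :+ (y :- x) :* n := y :* n) refl x y _ ⟩
        y * n · 1#                      ∎

-- Roots, real powers, and limits in the extended line

module RealPowers (em : ExcludedMiddle 0ℓ) (R : CompleteOrderedField) where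

  open CompleteOrderedField R hiding (zero) renaming (Carrier to ℝ)
  open LatticeExponents em R
  open IntegerEmbedding R
  open OrderedField em R
  open Solver using (solve; _:+_; _:*_; _:-_; :-_; con; _:=_)
  open TotalOrder totalOrder using (poset)
  open PartialOrderReasoning poset

  opaque

    -- Serves where no witness is constructed, namely for negative rational powers and for `𝔊`;
    -- there the default `0#` satisfies the wanted inequality as well.
    choose-cases : {X : Set} (d : X) (P : X → Set) → P (choose d P) ⊎ choose d P ≡ d
    choose-cases d P with em {∃ P}
    ... | yes (_ , Px) = inj₁ Px
    ... | no _         = inj₂ ≡.refl

    choose-spec : {X : Set} (d : X) (P : X → Set) → ∃ P → P (choose d P)
    choose-spec d P ∃P with em {∃ P}
    ... | yes (_ , Px) = Px
    ... | no ∄P        = contradiction ∃P ∄P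

  -- Roots

  opaque

    -- Quantitative continuity of powers, from which roots are obtained. Splitting off one factor
    -- `s + ε` gives the recursion from `K` to `M ^ n + M * K`.
    ^-lipschitz : ∀ n {M} → 0# < M → ∃[ K ] 0# < K ×
                  (∀ {s ε} → 0# ≤ s → 0# ≤ ε → s + ε ≤ M → (s + ε) ^ n ≤ s ^ n + ε * K)
    ^-lipschitz zero 0<M = 1# , 0<1 , λ {s} {ε} 0≤s 0≤ε _ → begin
      1#           ≈⟨ +-identityʳ 1# ⟨
      1# + 0#      ≤⟨ +-monoʳ-≤ 1# (*-nonNeg 0≤ε 0≤1) ⟩
      1# + ε * 1#  ∎
    ^-lipschitz (suc n) {M} 0<M with ^-lipschitz n 0<M
    ... | K , 0<K , bound = M ^ n + M * K , 0<K′ , bound′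
      where
      0<K′ : 0# < M ^ n + M * K
      0<K′ = begin-strict
        0#             ≈⟨ +-identityʳ 0# ⟨
        0# + 0#        ≤⟨ +-monoˡ-≤ 0# (^-nonNeg (proj₁ 0<M) n) ⟩
        M ^ n + 0#     <⟨ +-monoʳ-< (M ^ n) (*-pos 0<M 0<K) ⟩
        M ^ n + M * K  ∎
      bound′ : ∀ {s ε} → 0# ≤ s → 0# ≤ ε → s + ε ≤ M →
               (s + ε) ^ suc n ≤ s ^ suc n + ε * (M ^ n + M * K)
      bound′ {s} {ε} 0≤s 0≤ε s+ε≤M = begin
        (s + ε) * (s + ε) ^ n
          ≤⟨ *-monoʳ-≤ 0≤s+ε (bound 0≤s 0≤ε s+ε≤M) ⟩
        (s + ε) * (s ^ n + ε * K)
          ≈⟨ solve 4 (λ s ε p K → (s :+ ε) :* (p :+ ε :* K) := s :* p :+ ε :* (p :+ (s :+ ε) :* K))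
               refl s ε (s ^ n) K ⟩
        s ^ suc n + ε * (s ^ n + (s + ε) * K)
          ≤⟨ +-monoʳ-≤ _ (*-monoʳ-≤ 0≤ε (+-mono-≤ (^-mono-≤ n 0≤s s≤M) (*-monoˡ-≤ (proj₁ 0<K) s+ε≤M))) ⟩
        s ^ suc n + ε * (M ^ n + M * K) ∎
        where
        s≤s+ε : s ≤ s + ε
        s≤s+ε = ≤-trans (≤-reflexive (sym (+-identityʳ s))) (+-monoʳ-≤ s 0≤ε)
        0≤s+ε : 0# ≤ s + ε
        0≤s+ε = ≤-trans 0≤s s≤s+ε
        s≤M : s ≤ M
        s≤M = ≤-trans s≤s+ε s+ε≤M

  opaque

    -- Dividing `δ` by `K + δ` instead of `K` gives both upper bounds with a single witness.
    small : ∀ {δ K} → 0# < δ → 0# < K → ∃[ ε ] 0# < ε × ε ≤ 1# × ε * K ≤ δ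
    small {δ} {K} 0<δ 0<K = δ / (K + δ) , /-pos 0<δ 0<K+δ , *-cancelˡ-≤ 0<K+δ ε≤1 , εK≤δ
      where
      0<K+δ : 0# < K + δ
      0<K+δ = <-≤-trans 0<K (proj₁ (x<x+y K 0<δ))
      ε[K+δ]≈δ : δ / (K + δ) * (K + δ) ≈ δ
      ε[K+δ]≈δ = x/y*y≈x δ (pos⇒≉0 0<K+δ)
      ε≤1 : (K + δ) * (δ / (K + δ)) ≤ (K + δ) * 1#
      ε≤1 = begin
        (K + δ) * (δ / (K + δ))  ≈⟨ *-comm _ _ ⟩
        δ / (K + δ) * (K + δ)    ≈⟨ ε[K+δ]≈δ ⟩
        δ                        ≤⟨ proj₁ (x<x+y δ 0<K) ⟩
        δ + K                    ≈⟨ +-comm δ K ⟩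
        K + δ                    ≈⟨ *-identityʳ _ ⟨
        (K + δ) * 1#             ∎
      εK≤δ : δ / (K + δ) * K ≤ δ
      εK≤δ = begin
        δ / (K + δ) * K         ≤⟨ *-monoʳ-≤ (proj₁ (/-pos 0<δ 0<K+δ)) (proj₁ (x<x+y K 0<δ)) ⟩
        δ / (K + δ) * (K + δ)   ≈⟨ ε[K+δ]≈δ ⟩
        δ                       ∎

  module _ (n : ℕ) {x r : ℝ} (0≤r : 0# ≤ r)
    (r-upper : ∀ {s} → 0# ≤ s → s ^ suc n ≤ x → s ≤ r) where

    opaque

      -- If the power of `r` exceeded `x`, continuity would make `r - ε` an upper bound too: an
      -- admissible `s` above it would have a power too close to that of `r`.
      least-upper⇒rⁿ≤x : (∀ {u} → (∀ {s} → 0# ≤ s → s ^ suc n ≤ x → s ≤ u) → r ≤ u) → r ^ suc n ≤ x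
      least-upper⇒rⁿ≤x r-least = ≮⇒≥ absurd
        where
        absurd : ¬ x < r ^ suc n
        absurd x<rⁿ with ^-lipschitz (suc n) (≤-<-trans 0≤r (x<x+y r 0<1))
        ... | K , 0<K , lipschitz with small (x<y⇒0<y-x x<rⁿ) 0<K
        ...   | ε , 0<ε , _ , εK≤δ = <⇒≱ (x-y<x r 0<ε) (r-least λ 0≤s sⁿ≤x → ≮⇒≥ (s≯r-ε 0≤s sⁿ≤x))
          where
          s≯r-ε : ∀ {s} → 0# ≤ s → s ^ suc n ≤ x → ¬ r - ε < s
          s≯r-ε {s} 0≤s sⁿ≤x r-ε<s = <⇒≱ rⁿ<rⁿ ≤-refl
            where
            r≈s+[r-s] : r ≈ s + (r - s)
            r≈s+[r-s] = solve 2 (λ r s → r := s :+ (r :- s)) refl r s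
            r-s<ε : r - s < ε
            r-s<ε = begin-strict
              r - s             ≈⟨ solve 3 (λ r s ε → r :- s := ε :- s :+ (r :- ε)) refl r s ε ⟩
              ε - s + (r - ε)   <⟨ +-monoʳ-< _ r-ε<s ⟩
              ε - s + s         ≈⟨ solve 2 (λ s ε → ε :- s :+ s := ε) refl s ε ⟩
              ε                 ∎
            rⁿ<rⁿ : r ^ suc n < r ^ suc n
            rⁿ<rⁿ = begin-strict
              r ^ suc n                 ≈⟨ ^-congˡ (suc n) r≈s+[r-s] ⟩
              (s + (r - s)) ^ suc n     ≤⟨ lipschitz 0≤s (x≤y⇒0≤y-x (r-upper 0≤s sⁿ≤x))
                                            (≤-trans (≤-reflexive (sym r≈s+[r-s])) (proj₁ (x<x+y r 0<1))) ⟩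
              s ^ suc n + (r - s) * K   ≤⟨ +-monoˡ-≤ _ sⁿ≤x ⟩
              x + (r - s) * K           <⟨ +-monoʳ-< x (*-monoˡ-< 0<K r-s<ε) ⟩
              x + ε * K                 ≤⟨ +-monoʳ-≤ x εK≤δ ⟩
              x + (r ^ suc n - x)       ≈⟨ solve 2 (λ x p → x :+ (p :- x) := p) refl x (r ^ suc n) ⟩
              r ^ suc n                 ∎

    opaque

      -- If the power of `r` fell short of `x`, continuity would make `r + ε` admissible, above the
      -- upper bound `r`.
      upper⇒x≤rⁿ : x ≤ r ^ suc n
      upper⇒x≤rⁿ = ≮⇒≥ absurd
        where
        absurd : ¬ r ^ suc n < x
        absurd rⁿ<x with ^-lipschitz (suc n) (≤-<-trans 0≤r (x<x+y r 0<1))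
        ... | K , 0<K , lipschitz with small (x<y⇒0<y-x rⁿ<x) 0<K
        ...   | ε , 0<ε , ε≤1 , εK≤δ = <⇒≱ (x<x+y r 0<ε)
          (r-upper (≤-trans 0≤r (proj₁ (x<x+y r 0<ε))) (begin
            (r + ε) ^ suc n            ≤⟨ lipschitz 0≤r (proj₁ 0<ε) (+-monoʳ-≤ r ε≤1) ⟩
            r ^ suc n + ε * K          ≤⟨ +-monoʳ-≤ _ εK≤δ ⟩
            r ^ suc n + (x - r ^ suc n) ≈⟨ solve 2 (λ x p → p :+ (x :- p) := x) refl x (r ^ suc n) ⟩
            x                          ∎))

  opaque

    root : ∀ n {x} → 0# ≤ x → ∃[ s ] 0# ≤ s × s ^ suc n ≈ x
    root n {x} 0≤x with complete {∃[ s ] 0# ≤ s × s ^ suc n ≤ x} proj₁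
        (0# , ≤-refl , ≤-trans (≤-reflexive (zeroˡ _)) 0≤x) (1# + x , bounded)
      where
      1≤1+x : 1# ≤ 1# + x
      1≤1+x = ≤-trans (≤-reflexive (sym (+-identityʳ 1#))) (+-monoʳ-≤ 1# 0≤x)
      -- The base `1# + x` is at least `1#`, so its powers stay above it and hence above `x`,
      -- whatever the degree.
      bounded : ∀ ((s , _) : ∃[ s ] 0# ≤ s × s ^ suc n ≤ x) → s ≤ 1# + x
      bounded (s , 0≤s , sⁿ≤x) = ^-cancel-≤ n (≤-trans 0≤1 1≤1+x) (begin
        s ^ suc n              ≤⟨ sⁿ≤x ⟩
        x                      ≈⟨ +-identityˡ x ⟨
        0# + x                 ≤⟨ +-monoˡ-≤ x 0≤1 ⟩
        1# + x                 ≈⟨ *-identityʳ _ ⟨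
        (1# + x) * 1#          ≤⟨ *-monoʳ-≤ (≤-trans 0≤1 1≤1+x) (1≤x⇒1≤x^n n 1≤1+x) ⟩
        (1# + x) ^ suc n       ∎)
    ... | r , upper , least = r , 0≤r , antisym
        (least-upper⇒rⁿ≤x n 0≤r r-upper (λ s≤u → least _ λ (_ , 0≤s , sⁿ≤x) → s≤u 0≤s sⁿ≤x))
        (upper⇒x≤rⁿ n 0≤r r-upper)
      where
      r-upper : ∀ {s} → 0# ≤ s → s ^ suc n ≤ x → s ≤ r
      r-upper 0≤s sⁿ≤x = upper (_ , 0≤s , sⁿ≤x)
      0≤r : 0# ≤ r
      0≤r = r-upper ≤-refl (≤-trans (≤-reflexive (zeroˡ _)) 0≤x)

  opaque

    √-spec : ∀ {x} → 0# ≤ x → 0# ≤ √ x × √ x * √ x ≈ x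
    √-spec {x} 0≤x with root 1 0≤x
    ... | s , 0≤s , s²≈x = choose-spec 0# _ (s , 0≤s , trans (*-congˡ (sym (*-identityʳ s))) s²≈x)

  -- Powers with rational and real exponents

  opaque

    ^ᵠ-spec : ∀ {t} → 1# ≤ t → ∀ q {k} → ↥ q ≡ + k → 0# < t ^ᵠ q × (t ^ᵠ q) ^ ↧ₙ q ≈ t ^ k
    ^ᵠ-spec {t} 1≤t q@(mkℚ (+ k) d-1 _) ≡.refl with root d-1 (^-nonNeg (≤-trans 0≤1 1≤t) k)
    ... | s , 0≤s , sᵈ≈tᵏ = choose-spec 0# _ (s , (0≤s , 0≉s) , sᵈ≈tᵏ)
      where
      0≉s : 0# ≉ s
      0≉s 0≈s = pos⇒≉0 (^-pos (<-≤-trans 0<1 1≤t) k) (begin-equality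
        t ^ k            ≈⟨ sᵈ≈tᵏ ⟨
        s * s ^ d-1      ≈⟨ *-congʳ 0≈s ⟨
        0# * s ^ d-1     ≈⟨ zeroˡ _ ⟩
        0#               ∎)

  opaque

    1≤^ᵠ : ∀ {t} → 1# ≤ t → ∀ q {k} → ↥ q ≡ + k → 1# ≤ t ^ᵠ q
    1≤^ᵠ {t} 1≤t q@(mkℚ (+ k) d-1 _) ≡.refl = let 0<s , sᵈ≈tᵏ = ^ᵠ-spec 1≤t q ≡.refl in
      ^-cancel-≤ d-1 (proj₁ 0<s) (begin
        1# ^ suc d-1        ≈⟨ 1^n≈1 (suc d-1) ⟩
        1#                  ≤⟨ 1≤x⇒1≤x^n k 1≤t ⟩
        t ^ k               ≈⟨ sᵈ≈tᵏ ⟨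
        (t ^ᵠ q) ^ suc d-1  ∎)

  opaque

    ^ᵠ-mono-≤ : ∀ {t} → 1# ≤ t → ∀ p q {k} → ↥ q ≡ + k → fromℚ p ≤ fromℚ q → t ^ᵠ p ≤ t ^ᵠ q
    ^ᵠ-mono-≤ {t} 1≤t p@(mkℚ (+ j) c-1 _) q@(mkℚ (+ k) d-1 _) ≡.refl p≤q =
      -- The successor of this number is definitionally `suc c-1 ℕ.* suc d-1`.
      ^-cancel-≤ (d-1 ℕ.+ c-1 ℕ.* suc d-1) (proj₁ 0<t^q) (begin
        (t ^ᵠ p) ^ (suc c-1 ℕ.* suc d-1)   ≈⟨ ^-assocʳ (t ^ᵠ p) (suc c-1) (suc d-1) ⟨
        ((t ^ᵠ p) ^ suc c-1) ^ suc d-1     ≈⟨ ^-congˡ (suc d-1) (proj₂ (^ᵠ-spec 1≤t p ≡.refl)) ⟩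
        (t ^ j) ^ suc d-1                  ≈⟨ ^-assocʳ t j (suc d-1) ⟩
        t ^ (j ℕ.* suc d-1)                ≤⟨ ^-monoʳ-≤ 1≤t jd≤kc ⟩
        t ^ (k ℕ.* suc c-1)                ≈⟨ ^-assocʳ t k (suc c-1) ⟨
        (t ^ k) ^ suc c-1                  ≈⟨ ^-congˡ (suc c-1) (proj₂ (^ᵠ-spec 1≤t q ≡.refl)) ⟨
        ((t ^ᵠ q) ^ suc d-1) ^ suc c-1     ≈⟨ ^-assocʳ (t ^ᵠ q) (suc d-1) (suc c-1) ⟩
        (t ^ᵠ q) ^ (suc d-1 ℕ.* suc c-1)   ≈⟨ ^-congʳ (t ^ᵠ q) (ℕ.*-comm (suc d-1) (suc c-1)) ⟩
        (t ^ᵠ q) ^ (suc c-1 ℕ.* suc d-1)   ∎)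
      where
      0<t^q : 0# < t ^ᵠ q
      0<t^q = proj₁ (^ᵠ-spec 1≤t q ≡.refl)
      jd≤kc : j ℕ.* suc d-1 ℕ.≤ k ℕ.* suc c-1
      jd≤kc = ·1-cancel-≤ (begin
        (j ℕ.* suc d-1) · 1#   ≈⟨ ·1-homo-* j (suc d-1) ⟩
        j · 1# * suc d-1 · 1#             ≈⟨ *-congʳ (fromℚ*↧≈↥ p) ⟨
        fromℚ p * suc c-1 · 1# * suc d-1 · 1#        ≤⟨ *-monoˡ-≤ (0≤n·1 (suc d-1)) (*-monoˡ-≤ (0≤n·1 (suc c-1)) p≤q) ⟩
        fromℚ q * suc c-1 · 1# * suc d-1 · 1#        ≈⟨ solve 3 (λ q C D → q :* C :* D := q :* D :* C) refl _ _ _ ⟩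
        fromℚ q * suc d-1 · 1# * suc c-1 · 1#        ≈⟨ *-congʳ (fromℚ*↧≈↥ q) ⟩
        k · 1# * suc c-1 · 1#             ≈⟨ ·1-homo-* k (suc c-1) ⟨
        (k ℕ.* suc c-1) · 1#   ∎)
    ^ᵠ-mono-≤ {t} 1≤t p@(mkℚ -[1+ j ] c-1 _) q ↥q≡k p≤q
      with choose-cases 0# (λ s → 0# < s × s ^ ↧ₙ p ≈ t ^ᶻ ↥ p)
    -- The default value `0#` also lies below `1#`, so this branch needs no root.
    ... | inj₂ t^p≡0 = ≤-trans (≤-reflexive (reflexive t^p≡0)) (≤-trans 0≤1 (1≤^ᵠ 1≤t q ↥q≡k))
    ... | inj₁ (0<s , sᶜ≈t⁻ʲ) = ≤-trans t^p≤1 (1≤^ᵠ 1≤t q ↥q≡k)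
      where
      0<tʲ : 0# < t ^ suc j
      0<tʲ = ^-pos (<-≤-trans 0<1 1≤t) (suc j)
      t^p≤1 : t ^ᵠ p ≤ 1#
      t^p≤1 = ^-cancel-≤ c-1 0≤1 (begin
        (t ^ᵠ p) ^ suc c-1              ≈⟨ sᶜ≈t⁻ʲ ⟩
        (t ^ suc j) ⁻¹                  ≈⟨ *-identityˡ _ ⟨
        1# * (t ^ suc j) ⁻¹             ≤⟨ *-monoˡ-≤ (proj₁ (⁻¹-pos 0<tʲ)) (1≤x⇒1≤x^n (suc j) 1≤t) ⟩
        t ^ suc j * (t ^ suc j) ⁻¹      ≈⟨ ⁻¹-inverseʳ _ (pos⇒≉0 0<tʲ) ⟩
        1#                              ≈⟨ 1^n≈1 (suc c-1) ⟨
        1# ^ suc c-1                    ∎)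

  opaque

    nonNeg-fraction : ∀ m n → ∃[ q ] ∃[ k ] ↥ q ≡ + k × fromℚ q * suc n · 1# ≈ m · 1#
    nonNeg-fraction m n with fraction (+ m) (suc n)
    ... | q , q*n≈m with nonNeg⇒↥≡+ q (*-cancelˡ-≤ (0<[1+n]·1 n) (begin
        suc n · 1# * 0#       ≈⟨ zeroʳ _ ⟩
        0#                    ≤⟨ 0≤n·1 m ⟩
        m · 1#                ≈⟨ q*n≈m ⟨
        fromℚ q * suc n · 1#  ≈⟨ *-comm _ _ ⟩
        suc n · 1# * fromℚ q  ∎))
    ...   | k , ↥q≡k = q , k , ↥q≡k , q*n≈m

  opaque

    -- Completeness asks for one upper bound: a natural number above `γ`, viewed as a rational,
    -- provides it by monotonicity.
    ^ʳ-isLub : ∀ {t} → 1# ≤ t → ∀ {γ} → ∃[ q ] fromℚ q ≤ γ →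
               IsLub _≤_ (λ ((q , _) : ∃[ q ] fromℚ q ≤ γ) → t ^ᵠ q) (t ^ʳ γ)
    ^ʳ-isLub {t} 1≤t {γ} q≤γ with em {1# ≤ t}
    ... | no  1≰t = contradiction 1≤t 1≰t
    ... | yes _   with archimedean γ
    ...   | N , γ<N with nonNeg-fraction N 0
    ...     | q , n , ↥q≡n , q*1≈N = choose-spec 0# _ (complete _ q≤γ (t ^ᵠ q , λ (p , p≤γ) →
              ^ᵠ-mono-≤ 1≤t p q ↥q≡n (begin
                fromℚ p              ≤⟨ p≤γ ⟩
                γ                    ≤⟨ proj₁ γ<N ⟩
                N · 1#               ≈⟨ q*1≈N ⟨
                fromℚ q * (1# + 0#)  ≈⟨ *-congˡ (+-identityʳ 1#) ⟩
                fromℚ q * 1#         ≈⟨ *-identityʳ _ ⟩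
                fromℚ q              ∎)))

  opaque

    -- This and the next comparison are the only contact with real exponents: one weakens a uniform
    -- bound to a smaller rational exponent, the other evaluates a real power at a rational
    -- exponent.
    ^ᵠ≤^ʳ : ∀ {t} → 1# ≤ t → ∀ {γ} q → fromℚ q ≤ γ → t ^ᵠ q ≤ t ^ʳ γ
    ^ᵠ≤^ʳ 1≤t q q≤γ = proj₁ (^ʳ-isLub 1≤t (q , q≤γ)) (q , q≤γ)

    ^ʳ≤^ᵠ : ∀ {t} → 1# ≤ t → ∀ q {k} → ↥ q ≡ + k → t ^ʳ fromℚ q ≤ t ^ᵠ q
    ^ʳ≤^ᵠ {t} 1≤t q ↥q≡k = proj₂ (^ʳ-isLub 1≤t (q , ≤-refl)) (t ^ᵠ q)
      λ (p , p≤q) → ^ᵠ-mono-≤ 1≤t p q ↥q≡k p≤q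

  -- The extended real line

  open ExtremaNonStrict _≤_ using (⊥±≤⊥±; _≤⊤±; ⊥±≤_; [≤]-injective; ≤±-trans) renaming ([_] to [_]≤±)
  open ExtremaStrict _<_ using (⊥±<⊤±; [_]<⊤±)

  opaque

    [x]≰⊥± : ∀ {x} → ¬ [ x ] ≤± ⊥±
    [x]≰⊥± AddSupremum.[ () ]

    ⊤±≰ : ∀ {x} → x <± ⊤± → ¬ ⊤± ≤± x
    ⊤±≰ {⊥±}    _ ()
    ⊤±≰ {[ _ ]} _ ()
    ⊤±≰ {⊤±}    ()

  opaque

    -- Completeness is applied to the finite values alone. It has to be kept apart from three cases:
    -- `⊤±` is attained, there is no finite value, or the finite values are unbounded.
    lub± : {I : Set} (f : I → ℝ ±) → ∃ (IsLub _≤±_ f)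
    lub± {I} f with em {∃[ i ] f i ≡ ⊤±}
    ... | yes (i , fi≡⊤) = ⊤± , (λ j → f j ≤⊤±) , λ u f≤u → ≡.subst (_≤± u) fi≡⊤ (f≤u i)
    ... | no  f≢⊤ with em {∃[ x ] ∃[ i ] f i ≡ [ x ]}
    ...   | no  f≢[x] = ⊥± , f≤⊥ , λ u _ → ⊥±≤ u
      where
      f≤⊥ : ∀ i → f i ≤± ⊥±
      f≤⊥ i with f i in eq
      ... | ⊥±    = ⊥±≤⊥±
      ... | [ x ] = contradiction (x , i , eq) f≢[x]
      ... | ⊤±    = contradiction (i , eq) f≢⊤
    ...   | yes value@(x₀ , i₀ , fi₀≡x₀) with em {∃[ b ] (∀ ((x , _) : ∃[ x ] ∃[ i ] f i ≡ [ x ]) → x ≤ b)}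
    ...     | no unbounded = ⊤± , (λ j → f j ≤⊤±) , least-⊤
      where
      least-⊤ : ∀ u → (∀ i → f i ≤± u) → ⊤± ≤± u
      least-⊤ ⊥±    f≤u = contradiction (≡.subst (_≤± ⊥±) fi₀≡x₀ (f≤u i₀)) [x]≰⊥±
      least-⊤ [ u ] f≤u = contradiction (u , λ (x , i , fi≡x) →
        [≤]-injective (≡.subst (_≤± [ u ]) fi≡x (f≤u i))) unbounded
      least-⊤ ⊤±    f≤u = ⊤± ≤⊤±
    ...     | yes bound with complete proj₁ value bound
    ...       | s , upper , least-upper = [ s ] , f≤s , least-s
      where
      f≤s : ∀ i → f i ≤± [ s ]
      f≤s i with f i in eq
      ... | ⊥±    = ⊥±≤ [ s ]
      ... | [ x ] = [ upper (x , i , eq) ]≤±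
      ... | ⊤±    = contradiction (i , eq) f≢⊤
      least-s : ∀ u → (∀ i → f i ≤± u) → [ s ] ≤± u
      least-s ⊥±    f≤u = contradiction (≡.subst (_≤± ⊥±) fi₀≡x₀ (f≤u i₀)) [x]≰⊥±
      least-s [ u ] f≤u = [ least-upper u (λ (x , i , fi≡x) →
        [≤]-injective (≡.subst (_≤± [ u ]) fi≡x (f≤u i))) ]≤±
      least-s ⊤±    f≤u = [ s ] ≤⊤±

  opaque

    sup±-isLub : {I : Set} (f : I → ℝ ±) → IsLub _≤±_ f (sup± f)
    sup±-isLub f = choose-spec ⊥± _ (lub± f)

    inf±-isGlb : {I : Set} (f : I → ℝ ±) → IsGlb _≤±_ f (inf± f)
    inf±-isGlb f = choose-spec ⊤± (IsGlb _≤±_ f)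
      -- A greatest lower bound arises as the least upper bound of all lower bounds.
      (let g , lower≤g , g≤lower = lub± {∃[ l ] (∀ i → l ≤± f i)} proj₁ in
        g , (λ i → g≤lower (f i) λ (_ , l≤f) → l≤f i) , λ l l≤f → lower≤g (l , l≤f))

  opaque

    limsup<⊤⇒bounded : ∀ {f} → limsup f <± ⊤± → ∃[ T ] ∃[ C ] (∀ t → T ≤ t → f t ≤ C)
    limsup<⊤⇒bounded {f} limsup<⊤ with em {∃[ T ] ∃[ C ] (∀ t → T ≤ t → f t ≤ C)}
    ... | yes bounded  = bounded
    ... | no unbounded = contradiction (inf±-isGlb tailSup .proj₂ ⊤± ⊤≤tailSup) (⊤±≰ limsup<⊤)
      where
      tailSup : ℝ → ℝ ±
      tailSup T = sup± λ ((t , _) : ∃[ t ] T ≤ t) → [ f t ]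
      ⊤≤tailSup : ∀ T → ⊤± ≤± tailSup T
      ⊤≤tailSup T with tailSup T | sup±-isLub (λ ((t , _) : ∃[ t ] T ≤ t) → [ f t ])
      -- Every tail contains `T` itself, so its supremum is at least a real number.
      ... | ⊥±    | f≤s , _ = contradiction (f≤s (T , ≤-refl)) [x]≰⊥±
      ... | [ C ] | f≤s , _ = contradiction (T , C , λ t T≤t → [≤]-injective (f≤s (t , T≤t))) unbounded
      ... | ⊤±    | _       = ⊤± ≤⊤±

    frequentlyBounded⇒liminf<⊤ : ∀ {f K} → (∀ T → ∃[ t ] T ≤ t × f t ≤ K) → liminf f <± ⊤±
    frequentlyBounded⇒liminf<⊤ {f} {K} frequently = ≤[]⇒<⊤ (sup±-isLub tailInf .proj₂ [ K ] λ T →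
      let t , T≤t , ft≤K = frequently T in
      ≤±-trans ≤-trans (inf±-isGlb (λ ((t , _) : ∃[ t ] T ≤ t) → [ f t ]) .proj₁ (t , T≤t)) [ ft≤K ]≤±)
      where
      tailInf : ℝ → ℝ ±
      tailInf T = inf± λ ((t , _) : ∃[ t ] T ≤ t) → [ f t ]
      ≤[]⇒<⊤ : ∀ {x} → x ≤± [ K ] → x <± ⊤±
      ≤[]⇒<⊤ {⊥±}    _ = ⊥±<⊤±
      ≤[]⇒<⊤ {[ _ ]} _ = [ _ ]<⊤±
      ≤[]⇒<⊤ {⊤±}    ()

  opaque

    -- The form in which the failure of an ordinary exponent enters; it is applied with `K` equal to
    -- `1#`.
    liminf≮⊤⇒eventually-large : ∀ {f} → ¬ liminf f <± ⊤± → ∀ K → ∃[ T ] (∀ t → T ≤ t → K < f t)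
    liminf≮⊤⇒eventually-large {f} liminf≮⊤ K = ¬¬-elim λ ∄T →
      liminf≮⊤ (frequentlyBounded⇒liminf<⊤ {K = K} λ T → ¬¬-elim λ ∄t →
        ∄T (T , λ t T≤t → ≰⇒> λ ft≤K → ∄t (t , T≤t , ft≤K)))

    lub-above : ∀ {P : ℝ → Set} {s x} → IsLub _≤±_ (λ ((γ , _) : ∃ P) → [ γ ]) s → ¬ s ≤± [ x ] →
                ∃[ γ ] P γ × x < γ
    lub-above {x = x} (_ , least-upper) s≰x = ¬¬-elim λ ∄γ → s≰x (least-upper [ x ] λ (γ , Pγ) →
      [ ≮⇒≥ (λ x<γ → ∄γ (γ , Pγ , x<γ)) ]≤±)

-- Consecutive minimal points and the comparison of their radii

module MinimalPoints (em : ExcludedMiddle 0ℓ) (R : CompleteOrderedField) where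

  open CompleteOrderedField R hiding (zero) renaming (Carrier to ℝ)
  open IntegerEmbedding R
  open OrderedField em R
  open Solver using (solve; _:+_; _:*_; _:-_; :-_; con; _:=_)
  open TotalOrder totalOrder using (poset)
  open PartialOrderReasoning poset

  opaque

    ^-≤-* : ∀ m {x y z} → 0# ≤ x → x ≤ y * z → x ^ m ≤ y ^ m * z ^ m
    ^-≤-* m {x} {y} {z} 0≤x x≤yz = ≤-trans (^-mono-≤ m 0≤x x≤yz) (≤-reflexive (^-distrib-* y z m))

    ^-^-cong : ∀ x k l m n → k ℕ.* l ≡ m ℕ.* n → (x ^ k) ^ l ≈ (x ^ m) ^ n
    ^-^-cong x k l m n kl≡mn = begin-equality
      (x ^ k) ^ l    ≈⟨ ^-assocʳ x k l ⟩
      x ^ (k ℕ.* l)  ≈⟨ ^-congʳ x kl≡mn ⟩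
      x ^ (m ℕ.* n)  ≈⟨ ^-assocʳ x m n ⟨
      (x ^ m) ^ n    ∎

  opaque

    -- Raising the hypotheses to the powers a c, n c and n a eliminates s and u.
    radius-bound : ∀ n a c → c ℕ.* (n ℕ.* c) ℕ.< a ℕ.* (n ℕ.* a) ℕ.+ a ℕ.* (a ℕ.* c) →
      ∀ {δ K C} → 0# < δ → 0# ≤ K → 0# ≤ C →
      ∃[ B ] (∀ {s r u} → 0# ≤ s → 1# ≤ r → 0# ≤ u →
              δ * (s ^ n * r ^ a) ≤ K * u ^ n →
              u ^ a ≤ C * r ^ c →
              r ^ a ≤ C * s ^ c →
              r ≤ B)
    radius-bound n a c exponents {δ} {K} {C} 0<δ 0≤K 0≤C = L / δᵉ , λ {s} {r} {u} 0≤s 1≤r 0≤u δsr≤Ku u≤Cr r≤Cs →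
      let 0≤r = ≤-trans 0≤1 1≤r
          0<r^p = ^-pos (<-≤-trans 0<1 1≤r) p in
      *-cancelˡ-≤ (*-pos 0<δᵉ 0<r^p) (begin
        δᵉ * r ^ p * r
          ≈⟨ solve 3 (λ d q r → d :* q :* r := d :* (r :* q)) refl δᵉ (r ^ p) r ⟩
        -- Strictness of `exponents` supplies one factor `r` beyond `r ^ p`; that spare factor is
        -- what gets bounded.
        δᵉ * r ^ suc p
          ≤⟨ *-monoʳ-≤ (proj₁ 0<δᵉ) (^-monoʳ-≤ 1≤r exponents) ⟩
        δᵉ * r ^ (a ℕ.* (n ℕ.* a) ℕ.+ a ℕ.* e)
          ≈⟨ *-congˡ (trans (^-homo-* r (a ℕ.* (n ℕ.* a)) (a ℕ.* e))
               (*-cong (sym (^-assocʳ r a (n ℕ.* a))) (sym (^-assocʳ r a e)))) ⟩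
        δᵉ * ((r ^ a) ^ (n ℕ.* a) * (r ^ a) ^ e)
          ≤⟨ *-monoʳ-≤ (proj₁ 0<δᵉ) (*-monoˡ-≤ (^-nonNeg (^-nonNeg 0≤r a) e)
               (^-≤-* (n ℕ.* a) (^-nonNeg 0≤r a) r≤Cs)) ⟩
        δᵉ * (C ^ (n ℕ.* a) * (s ^ c) ^ (n ℕ.* a) * (r ^ a) ^ e)
          ≈⟨ *-congˡ (*-congʳ (*-congˡ (^-^-cong s c (n ℕ.* a) n e (exponent₁ c n a)))) ⟩
        δᵉ * (C ^ (n ℕ.* a) * (s ^ n) ^ e * (r ^ a) ^ e)
          ≈⟨ solve 4 (λ d x y z → d :* (x :* y :* z) := x :* (d :* (y :* z))) refl δᵉ (C ^ (n ℕ.* a)) ((s ^ n) ^ e) ((r ^ a) ^ e) ⟩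
        C ^ (n ℕ.* a) * (δᵉ * ((s ^ n) ^ e * (r ^ a) ^ e))
          ≈⟨ *-congˡ (trans (^-distrib-* δ _ e) (*-congˡ (^-distrib-* (s ^ n) (r ^ a) e))) ⟨
        C ^ (n ℕ.* a) * (δ * (s ^ n * r ^ a)) ^ e
          ≤⟨ *-monoʳ-≤ (^-nonNeg 0≤C (n ℕ.* a)) (^-≤-* e (*-nonNeg (proj₁ 0<δ) (*-nonNeg (^-nonNeg 0≤s n) (^-nonNeg 0≤r a))) δsr≤Ku) ⟩
        C ^ (n ℕ.* a) * (K ^ e * (u ^ n) ^ e)
          ≈⟨ *-congˡ (*-congˡ (^-^-cong u n e a (n ℕ.* c) (exponent₂ n a c))) ⟩
        C ^ (n ℕ.* a) * (K ^ e * (u ^ a) ^ (n ℕ.* c))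
          ≤⟨ *-monoʳ-≤ (^-nonNeg 0≤C (n ℕ.* a)) (*-monoʳ-≤ (^-nonNeg 0≤K e) (^-≤-* (n ℕ.* c) (^-nonNeg 0≤u a) u≤Cr)) ⟩
        C ^ (n ℕ.* a) * (K ^ e * (C ^ (n ℕ.* c) * (r ^ c) ^ (n ℕ.* c)))
          ≈⟨ *-congˡ (*-congˡ (*-congˡ (^-assocʳ r c (n ℕ.* c)))) ⟩
        C ^ (n ℕ.* a) * (K ^ e * (C ^ (n ℕ.* c) * r ^ p))
          ≈⟨ solve 4 (λ x y z q → x :* (y :* (z :* q)) := x :* (y :* z) :* q) refl (C ^ (n ℕ.* a)) (K ^ e) (C ^ (n ℕ.* c)) (r ^ p) ⟩
        L * r ^ p
          ≈⟨ *-congʳ (x/y*y≈x L (pos⇒≉0 0<δᵉ)) ⟨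
        L / δᵉ * δᵉ * r ^ p
          ≈⟨ solve 3 (λ l d q → l :* d :* q := d :* q :* l) refl (L / δᵉ) δᵉ (r ^ p) ⟩
        δᵉ * r ^ p * (L / δᵉ) ∎)
      where
      e p : ℕ
      e = a ℕ.* c
      p = c ℕ.* (n ℕ.* c)
      δᵉ L : ℝ
      δᵉ = δ ^ e
      L = C ^ (n ℕ.* a) * (K ^ e * C ^ (n ℕ.* c))
      0<δᵉ : 0# < δᵉ
      0<δᵉ = ^-pos 0<δ e
      exponent₁ : ∀ c n a → c ℕ.* (n ℕ.* a) ≡ n ℕ.* (a ℕ.* c)
      exponent₁ = ℕ-Tactic.solve-∀
      exponent₂ : ∀ n a c → n ℕ.* (a ℕ.* c) ≡ a ℕ.* (n ℕ.* c)
      exponent₂ = ℕ-Tactic.solve-∀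

  opaque

    -- Here `x` and `x′` are the coordinates along the common axis. For parallel points, `x ≤ x′`
    -- would make the product grow, against `x′ * y′ < x * y`. Otherwise the bound on `d` is
    -- multiplied by `x`: its first term x²y′ is at most x(x′y′), and its second is x′(xy), so both
    -- are at most `x′ * (x * y)`.
    same-axis : ∀ {d x y x′ y′} → 0# < x → 0# < y → 0# < x′ → 0# < y′ →
      x * y′ ≈ x′ * y ⊎ d ≤ x * y′ + x′ * y →
      x ≤ x′ → x′ * y′ < x * y → d * x ≤ x′ * (x * y) + x′ * (x * y)
    same-axis {d} {x} {y} {x′} {y′} 0<x 0<y 0<x′ 0<y′ (inj₁ xy′≈x′y) x≤x′ N′<N =
      contradiction (*-cancelˡ-≤ 0<x (begin
        x * (x * y)     ≤⟨ *-mono-≤ (proj₁ 0<x) (*-nonNeg (proj₁ 0<x′) (proj₁ 0<y)) x≤x′ (*-monoˡ-≤ (proj₁ 0<y) x≤x′) ⟩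
        x′ * (x′ * y)   ≈⟨ *-congˡ xy′≈x′y ⟨
        x′ * (x * y′)   ≈⟨ solve 3 (λ x x′ y′ → x′ :* (x :* y′) := x :* (x′ :* y′)) refl x x′ y′ ⟩
        x * (x′ * y′)   ∎)) (<⇒≱ N′<N)
    same-axis {d} {x} {y} {x′} {y′} 0<x 0<y 0<x′ 0<y′ (inj₂ d≤) x≤x′ N′<N = begin
      d * x                            ≤⟨ *-monoˡ-≤ (proj₁ 0<x) d≤ ⟩
      (x * y′ + x′ * y) * x            ≈⟨ solve 4 (λ x y x′ y′ → (x :* y′ :+ x′ :* y) :* x := x :* (x :* y′) :+ x′ :* (x :* y)) refl x y x′ y′ ⟩
      x * (x * y′) + x′ * (x * y)      ≤⟨ +-monoˡ-≤ _ (*-monoʳ-≤ (proj₁ 0<x) (*-monoˡ-≤ (proj₁ 0<y′) x≤x′)) ⟩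
      x * (x′ * y′) + x′ * (x * y)     ≤⟨ +-monoˡ-≤ _ (*-mono-≤ (proj₁ 0<x) (proj₁ (*-pos 0<x 0<y)) x≤x′ (proj₁ N′<N)) ⟩
      x′ * (x * y) + x′ * (x * y)      ∎

  2# : ℝ
  2# = 1# + 1#

  opaque

    0<2 : 0# < 2#
    0<2 = <-≤-trans 0<1 (proj₁ (x<x+y 1# 0<1))

    half : ∀ x → x / 2# * 2# ≈ x
    half x = x/y*y≈x x (pos⇒≉0 0<2)

  -- All that the argument needs of a lattice: positive absolute coordinates, coming from
  -- irrationality; `separated`, coming from integrality of determinants; and `argmin`, coming from
  -- finiteness of balls.
  module _ {I : Set} (x y : I → ℝ) (0<x : ∀ i → 0# < x i) (0<y : ∀ i → 0# < y i)
    {d : ℝ} (0<d : 0# < d)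
    (separated : ∀ i j → x i * y j ≈ x j * y i ⊎ d ≤ x i * y j + x j * y i)
    (argmin : ∀ (f : I → ℝ) (P : I → Set) r → ∃[ i ] P i × x i ⊔ y i ≤ r →
              ∃[ i ] (P i × x i ⊔ y i ≤ r) × (∀ j → P j → x j ⊔ y j ≤ r → f i ≤ f j))
    where

    private
      t N : I → ℝ
      t i = x i ⊔ y i
      N i = x i * y i

      SameAxis : I → I → Set
      SameAxis i j = (y i ≤ x i × y j ≤ x j) ⊎ (x i ≤ y i × x j ≤ y j)

    opaque

      0<t : ∀ i → 0# < t i
      0<t i = <-≤-trans (0<x i) (x≤x⊔y (x i) (y i))

      0<N : ∀ i → 0# < N i
      0<N i = *-pos (0<x i) (0<y i)

      same-axis-separated : ∀ {i j} → SameAxis i j → t i ≤ t j → N j < N i →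
                            d * t i ≤ 2# * t j * N i
      same-axis-separated {i} {j} (inj₁ (yᵢ≤xᵢ , yⱼ≤xⱼ)) tᵢ≤tⱼ Nⱼ<Nᵢ = begin
        d * t i                    ≈⟨ *-congˡ tᵢ≈xᵢ ⟩
        d * x i                    ≤⟨ same-axis (0<x i) (0<y i) (0<x j) (0<y j) (separated i j)
                                        (≤-respʳ-≈ tⱼ≈xⱼ (≤-respˡ-≈ tᵢ≈xᵢ tᵢ≤tⱼ)) Nⱼ<Nᵢ ⟩
        x j * N i + x j * N i      ≈⟨ solve 2 (λ t N → t :* N :+ t :* N := con (+ 2) :* t :* N) refl (x j) (N i) ⟩
        2# * x j * N i             ≈⟨ *-congʳ (*-congˡ tⱼ≈xⱼ) ⟨
        2# * t j * N i             ∎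
        where
        tᵢ≈xᵢ : t i ≈ x i
        tᵢ≈xᵢ = x≤y⇒y⊔x≈y yᵢ≤xᵢ
        tⱼ≈xⱼ : t j ≈ x j
        tⱼ≈xⱼ = x≤y⇒y⊔x≈y yⱼ≤xⱼ
      same-axis-separated {i} {j} (inj₂ (xᵢ≤yᵢ , xⱼ≤yⱼ)) tᵢ≤tⱼ Nⱼ<Nᵢ = begin
        d * t i                                  ≈⟨ *-congˡ tᵢ≈yᵢ ⟩
        d * y i                                  ≤⟨ same-axis (0<y i) (0<x i) (0<y j) (0<x j) (flip-separated (separated i j))
                                                      (≤-respʳ-≈ tⱼ≈yⱼ (≤-respˡ-≈ tᵢ≈yᵢ tᵢ≤tⱼ))
                                                      (begin-strict
                                                        y j * x j  ≈⟨ *-comm _ _ ⟩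
                                                        x j * y j  <⟨ Nⱼ<Nᵢ ⟩
                                                        x i * y i  ≈⟨ *-comm _ _ ⟩
                                                        y i * x i  ∎) ⟩
        y j * (y i * x i) + y j * (y i * x i)    ≈⟨ solve 3 (λ t x y → t :* (y :* x) :+ t :* (y :* x) := con (+ 2) :* t :* (x :* y)) refl (y j) (x i) (y i) ⟩
        2# * y j * N i                           ≈⟨ *-congʳ (*-congˡ tⱼ≈yⱼ) ⟨
        2# * t j * N i                           ∎
        where
        tᵢ≈yᵢ : t i ≈ y i
        tᵢ≈yᵢ = x≤y⇒x⊔y≈y xᵢ≤yᵢ
        tⱼ≈yⱼ : t j ≈ y j
        tⱼ≈yⱼ = x≤y⇒x⊔y≈y xⱼ≤yⱼ
        flip-separated : x i * y j ≈ x j * y i ⊎ d ≤ x i * y j + x j * y i →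
                         y i * x j ≈ y j * x i ⊎ d ≤ y i * x j + y j * x i
        flip-separated (inj₁ eq) = inj₁ (trans (*-comm _ _) (trans (sym eq) (*-comm _ _)))
        flip-separated (inj₂ d≤) = inj₂ (≤-trans d≤ (≤-reflexive
          (solve 4 (λ a b c e → a :* b :+ c :* e := e :* c :+ b :* a) refl (x i) (y j) (x j) (y i))))

      pigeonhole : ∀ i j k → SameAxis i j ⊎ SameAxis i k ⊎ SameAxis j k
      pigeonhole i j k with total (y i) (x i) | total (y j) (x j) | total (y k) (x k)
      ... | inj₁ p | inj₁ q | _      = inj₁ (inj₁ (p , q))
      ... | inj₂ p | inj₂ q | _      = inj₁ (inj₂ (p , q))
      ... | inj₁ p | inj₂ _ | inj₁ q = inj₂ (inj₁ (inj₁ (p , q)))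
      ... | inj₂ p | inj₁ _ | inj₂ q = inj₂ (inj₁ (inj₂ (p , q)))
      ... | inj₁ _ | inj₂ p | inj₂ q = inj₂ (inj₂ (inj₂ (p , q)))
      ... | inj₂ _ | inj₁ p | inj₁ q = inj₂ (inj₂ (inj₁ (p , q)))

      -- Turns smallness of `N` into largeness of the radius: the minimum of `N` over the ball is
      -- attained and positive, and a smaller value can only occur outside.
      far : ∀ r → ∃[ ε ] 0# < ε × (∀ i → N i < ε → r < t i)
      far r with em {∃[ i ] ⊤ × t i ≤ r}
      ... | no  none = 1# , 0<1 , λ i _ → ≰⇒> λ tᵢ≤r → none (i , tt , tᵢ≤r)
      ... | yes some with argmin N (λ _ → ⊤) r some
      ...   | k , _ , Nₖ≤ = N k , 0<N k , λ i Nᵢ<Nₖ → ≰⇒> λ tᵢ≤r → <⇒≱ Nᵢ<Nₖ (Nₖ≤ i tt tᵢ≤r)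

    -- With a/n = 2γ and c/n = 2β, `exponents` is β² < γ² + 2γ²β multiplied by 4n³.
    module _ (n-1 a-1 c : ℕ) {T C : ℝ} (0≤C : 0# ≤ C)
      (exponents : c ℕ.* (suc n-1 ℕ.* c) ℕ.< suc a-1 ℕ.* (suc n-1 ℕ.* suc a-1) ℕ.+ suc a-1 ℕ.* (suc a-1 ℕ.* c))
      (uniform : ∀ r → T ≤ r → ∃[ i ] t i ≤ r × N i ^ suc n-1 * r ^ suc a-1 ≤ C)
      (ordinary : ∀ i → T ≤ t i → 1# ≤ N i ^ suc n-1 * t i ^ c)
      where

      private
        n a : ℕ
        n = suc n-1
        a = suc a-1

        -- The factor `2# ^ a` pays for applying the uniform bound at half of the next radius.
        C′ : ℝ
        C′ = C * 2# ^ a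

      opaque

        0≤C′ : 0# ≤ C′
        0≤C′ = *-nonNeg 0≤C (proj₁ (^-pos 0<2 a))

        -- The exponent `a` is at least one, so the uniform bound forces `N` to zero as the radius
        -- grows.
        arbitrarily-small : ∀ {ε} → 0# < ε → ∃[ i ] N i < ε
        -- The last entry makes `ε ^ n * r` exceed `C`; the entry `1#` ensures `r ≤ r ^ a`.
        arbitrarily-small {ε} 0<ε with uniform (T ⊔ (1# ⊔ (C / ε ^ n + 1#))) (x≤x⊔y _ _)
        ... | i , _ , Nr≤C = i , ≰⇒> λ ε≤N → <⇒≱ (begin-strict
            C                              <⟨ x<x+y C 0<εⁿ ⟩
            C + ε ^ n                      ≈⟨ +-congʳ (x/y*y≈x C (pos⇒≉0 0<εⁿ)) ⟨
            C / ε ^ n * ε ^ n + ε ^ n      ≈⟨ solve 2 (λ q e → q :* e :+ e := e :* (q :+ con (+ 1))) refl (C / ε ^ n) (ε ^ n) ⟩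
            ε ^ n * (C / ε ^ n + 1#)       ≤⟨ *-monoʳ-≤ (proj₁ 0<εⁿ) (≤-trans (x≤y⊔x 1# _) r₁≤r) ⟩
            ε ^ n * r                      ≤⟨ *-monoʳ-≤ (proj₁ 0<εⁿ) r≤rᵃ ⟩
            ε ^ n * r ^ a                  ≤⟨ *-monoˡ-≤ (^-nonNeg 0≤r a) (^-mono-≤ n (proj₁ 0<ε) ε≤N) ⟩
            N i ^ n * r ^ a                ∎) Nr≤C
          where
          r : ℝ
          r = T ⊔ (1# ⊔ (C / ε ^ n + 1#))
          0<εⁿ : 0# < ε ^ n
          0<εⁿ = ^-pos 0<ε n
          r₁≤r : 1# ⊔ (C / ε ^ n + 1#) ≤ r
          r₁≤r = x≤y⊔x T _
          1≤r : 1# ≤ r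
          1≤r = ≤-trans (x≤x⊔y 1# _) r₁≤r
          0≤r : 0# ≤ r
          0≤r = ≤-trans 0≤1 1≤r
          r≤rᵃ : r ≤ r ^ a
          r≤rᵃ = begin
            r               ≈⟨ *-identityʳ r ⟨
            r * 1#          ≤⟨ *-monoʳ-≤ 0≤r (1≤x⇒1≤x^n a-1 1≤r) ⟩
            r * r ^ a-1     ∎

      opaque

        -- With `ε` equal to `N i` this yields the minimal point after `i`. Any point with `N` below
        -- `ε` provides a ball in which `argmin` can search.
        next : ∀ {ε} → 0# < ε → ∃[ i ] N i < ε × (∀ j → N j < ε → t i ≤ t j)
        next {ε} 0<ε with arbitrarily-small 0<ε
        ... | k , Nₖ<ε with argmin t (λ i → N i < ε) (t k) (k , Nₖ<ε , ≤-refl)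
        ...   | i , (Nᵢ<ε , tᵢ≤tₖ) , tᵢ≤ = i , Nᵢ<ε , λ j Nⱼ<ε →
          -- Points outside the searched ball are farther away than the one found.
          [ tᵢ≤ j Nⱼ<ε , (λ tₖ<tⱼ → ≤-trans tᵢ≤tₖ (proj₁ tₖ<tⱼ)) ]′ (≤-<-total (t j) (t k))

      opaque

        -- The uniform bound just before the radius t j, where N i is still minimal.
        gap : ∀ {i j} → T + T ≤ t j → (∀ k → N k < N i → t j ≤ t k) → N i ^ n * t j ^ a ≤ C′
        gap {i} {j} 2T≤tⱼ j-next with uniform (t j / 2#) (*-cancelˡ-≤ 0<2 (begin
            2# * T            ≈⟨ solve 1 (λ T → con (+ 2) :* T := T :+ T) refl T ⟩
            T + T             ≤⟨ 2T≤tⱼ ⟩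
            t j               ≈⟨ half (t j) ⟨
            t j / 2# * 2#     ≈⟨ *-comm _ _ ⟩
            2# * (t j / 2#)   ∎))
        ... | k , tₖ≤r , Nr≤C = begin
            N i ^ n * t j ^ a               ≈⟨ *-congˡ (^-congˡ a (half (t j))) ⟨
            N i ^ n * (r * 2#) ^ a          ≈⟨ *-congˡ (^-distrib-* r 2# a) ⟩
            N i ^ n * (r ^ a * 2# ^ a)      ≈⟨ *-assoc _ _ _ ⟨
            N i ^ n * r ^ a * 2# ^ a        ≤⟨ *-monoˡ-≤ (proj₁ (^-pos 0<2 a)) (begin
              N i ^ n * r ^ a                 ≤⟨ *-monoˡ-≤ (proj₁ (^-pos 0<r a)) (^-mono-≤ n (proj₁ (0<N i)) Nᵢ≤Nₖ) ⟩
              N k ^ n * r ^ a                 ≤⟨ Nr≤C ⟩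
              C                               ∎) ⟩
            C′                              ∎
          where
          r : ℝ
          r = t j / 2#
          0<r : 0# < r
          0<r = /-pos (0<t j) 0<2
          r<tⱼ : r < t j
          r<tⱼ = begin-strict
            r        <⟨ x<x+y r 0<r ⟩
            r + r    ≈⟨ solve 1 (λ r → r :+ r := r :* con (+ 2)) refl r ⟩
            r * 2#   ≈⟨ half (t j) ⟩
            t j      ∎
          Nᵢ≤Nₖ : N i ≤ N k
          Nᵢ≤Nₖ = ≮⇒≥ λ Nₖ<Nᵢ → <⇒≱ (≤-<-trans tₖ≤r r<tⱼ) (j-next k Nₖ<Nᵢ)

        growth : ∀ {i j} → T ≤ t i → N i ^ n * t j ^ a ≤ C′ → t j ^ a ≤ C′ * t i ^ c
        growth {i} {j} T≤tᵢ Nt≤C′ = begin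
          t j ^ a                          ≈⟨ *-identityˡ _ ⟨
          1# * t j ^ a                     ≤⟨ *-monoˡ-≤ (proj₁ (^-pos (0<t j) a)) (ordinary i T≤tᵢ) ⟩
          N i ^ n * t i ^ c * t j ^ a      ≈⟨ solve 3 (λ x y z → x :* y :* z := x :* z :* y) refl (N i ^ n) (t i ^ c) (t j ^ a) ⟩
          N i ^ n * t j ^ a * t i ^ c      ≤⟨ *-monoˡ-≤ (proj₁ (^-pos (0<t i) c)) Nt≤C′ ⟩
          C′ * t i ^ c                     ∎

        -- The partner `l` on the common axis is kept apart from `j`, where the uniform bound is
        -- read, and from `k`, the last radius. So a single inequality covers every pair given by
        -- `pigeonhole`.
        separation : ∀ {i j k l} → SameAxis i l → t i ≤ t l → N l < N i → t l ≤ t k →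
                     N i ^ n * t j ^ a ≤ C′ →
                     d ^ n * (t i ^ n * t j ^ a) ≤ 2# ^ n * C′ * t k ^ n
        separation {i} {j} {k} {l} axis tᵢ≤tₗ Nₗ<Nᵢ tₗ≤tₖ Nt≤C′ = begin
          d ^ n * (t i ^ n * t j ^ a)                    ≈⟨ *-assoc _ _ _ ⟨
          d ^ n * t i ^ n * t j ^ a                      ≈⟨ *-congʳ (^-distrib-* d (t i) n) ⟨
          (d * t i) ^ n * t j ^ a                        ≤⟨ *-monoˡ-≤ (proj₁ (^-pos (0<t j) a)) (^-mono-≤ n (proj₁ (*-pos 0<d (0<t i))) (begin
            d * t i                                        ≤⟨ same-axis-separated axis tᵢ≤tₗ Nₗ<Nᵢ ⟩
            2# * t l * N i                                 ≤⟨ *-monoˡ-≤ (proj₁ (0<N i)) (*-monoʳ-≤ (proj₁ 0<2) tₗ≤tₖ) ⟩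
            2# * t k * N i                                 ∎)) ⟩
          (2# * t k * N i) ^ n * t j ^ a                 ≈⟨ *-congʳ (trans (^-distrib-* _ (N i) n) (*-congʳ (^-distrib-* 2# (t k) n))) ⟩
          2# ^ n * t k ^ n * N i ^ n * t j ^ a           ≈⟨ *-assoc _ _ _ ⟩
          2# ^ n * t k ^ n * (N i ^ n * t j ^ a)         ≤⟨ *-monoʳ-≤ (*-nonNeg (proj₁ (^-pos 0<2 n)) (proj₁ (^-pos (0<t k) n))) Nt≤C′ ⟩
          2# ^ n * t k ^ n * C′                          ≈⟨ solve 3 (λ x y z → x :* y :* z := x :* z :* y) refl (2# ^ n) (t k ^ n) C′ ⟩
          2# ^ n * C′ * t k ^ n                          ∎

      opaque

        uniform-ordinary-absurd : ⊥
        uniform-ordinary-absurd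
          with radius-bound n a c exponents (^-pos 0<d n) (*-nonNeg (proj₁ (^-pos 0<2 n)) 0≤C′) 0≤C′
        -- Beyond this radius all bounds apply: `T + T` allows halving in `gap`, `T` is for
        -- `ordinary`, and `1#` and `B` are for `radius-bound`.
        ... | B , bound with far ((T + T) ⊔ (T ⊔ (1# ⊔ B)))
        ... | ε , 0<ε , Nᵢ<ε⇒r<tᵢ with next 0<ε
        ... | i , Nᵢ<ε , i-next with next (0<N i)
        ... | j , Nⱼ<Nᵢ , j-next with next (0<N j)
        -- The fourth point serves the pair `j`, `k`, for which the triple of radii is that of `j`,
        -- `k`, `l`.
        ... | k , Nₖ<Nⱼ , k-next with next (0<N k)
        ... | l , Nₗ<Nₖ , l-next = absurd (pigeonhole i j k)
          where
          r : ℝ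
          r = (T + T) ⊔ (T ⊔ (1# ⊔ B))
          Nⱼ<ε : N j < ε
          Nⱼ<ε = <-≤-trans Nⱼ<Nᵢ (proj₁ Nᵢ<ε)
          Nₖ<ε : N k < ε
          Nₖ<ε = <-≤-trans Nₖ<Nⱼ (proj₁ Nⱼ<ε)
          Nₗ<ε : N l < ε
          Nₗ<ε = <-≤-trans Nₗ<Nₖ (proj₁ Nₖ<ε)
          2T≤t : ∀ m → N m < ε → T + T ≤ t m
          2T≤t m Nₘ<ε = ≤-trans (x≤x⊔y (T + T) _) (proj₁ (Nᵢ<ε⇒r<tᵢ m Nₘ<ε))
          T≤t : ∀ m → N m < ε → T ≤ t m
          T≤t m Nₘ<ε = ≤-trans (≤-trans (x≤x⊔y T _) (x≤y⊔x (T + T) _)) (proj₁ (Nᵢ<ε⇒r<tᵢ m Nₘ<ε))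
          1⊔B≤r : 1# ⊔ B ≤ r
          1⊔B≤r = ≤-trans (x≤y⊔x T _) (x≤y⊔x (T + T) _)
          1≤t : ∀ m → N m < ε → 1# ≤ t m
          1≤t m Nₘ<ε = ≤-trans (≤-trans (x≤x⊔y 1# B) 1⊔B≤r) (proj₁ (Nᵢ<ε⇒r<tᵢ m Nₘ<ε))
          B<t : ∀ m → N m < ε → B < t m
          B<t m Nₘ<ε = ≤-<-trans (≤-trans (x≤y⊔x 1# B) 1⊔B≤r) (Nᵢ<ε⇒r<tᵢ m Nₘ<ε)
          tᵢ≤tⱼ : t i ≤ t j
          tᵢ≤tⱼ = i-next j Nⱼ<ε
          tⱼ≤tₖ : t j ≤ t k
          tⱼ≤tₖ = j-next k (<-≤-trans Nₖ<Nⱼ (proj₁ Nⱼ<Nᵢ))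
          tₖ≤tₗ : t k ≤ t l
          tₖ≤tₗ = k-next l (<-≤-trans Nₗ<Nₖ (proj₁ Nₖ<Nⱼ))
          gapᵢⱼ : N i ^ n * t j ^ a ≤ C′
          gapᵢⱼ = gap (2T≤t j Nⱼ<ε) j-next
          gapⱼₖ : N j ^ n * t k ^ a ≤ C′
          gapⱼₖ = gap (2T≤t k Nₖ<ε) k-next
          gapₖₗ : N k ^ n * t l ^ a ≤ C′
          gapₖₗ = gap (2T≤t l Nₗ<ε) l-next
          tⱼ≰B : ∀ m → SameAxis i m → t i ≤ t m → N m < N i → ¬ t m ≤ t k
          tⱼ≰B m axis tᵢ≤tₘ Nₘ<Nᵢ tₘ≤tₖ = <⇒≱ (B<t j Nⱼ<ε) (bound (proj₁ (0<t i)) (1≤t j Nⱼ<ε) (proj₁ (0<t k))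
            (separation axis tᵢ≤tₘ Nₘ<Nᵢ tₘ≤tₖ gapᵢⱼ) (growth (T≤t j Nⱼ<ε) gapⱼₖ) (growth (T≤t i Nᵢ<ε) gapᵢⱼ))
          absurd : ¬ (SameAxis i j ⊎ SameAxis i k ⊎ SameAxis j k)
          absurd (inj₁ axis)        = tⱼ≰B j axis tᵢ≤tⱼ Nⱼ<Nᵢ tⱼ≤tₖ
          absurd (inj₂ (inj₁ axis)) = tⱼ≰B k axis (≤-trans tᵢ≤tⱼ tⱼ≤tₖ) (<-≤-trans Nₖ<Nⱼ (proj₁ Nⱼ<Nᵢ)) ≤-refl
          absurd (inj₂ (inj₂ axis)) = <⇒≱ (B<t k Nₖ<ε) (bound (proj₁ (0<t j)) (1≤t k Nₖ<ε) (proj₁ (0<t l))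
            (separation axis tⱼ≤tₖ Nₖ<Nⱼ tₖ≤tₗ gapⱼₖ) (growth (T≤t k Nₖ<ε) gapₖₗ) (growth (T≤t j Nⱼ<ε) gapⱼₖ))

-- Minimisation over finitely many integer points

module Lattice (em : ExcludedMiddle 0ℓ) (R : CompleteOrderedField) where

  open CompleteOrderedField R hiding (zero) renaming (Carrier to ℝ)
  open LatticeExponents em R
  open IntegerEmbedding R
  open OrderedField em R
  open RealPowers em R
  open MinimalPoints em R
  open Solver using (solve; _:+_; _:*_; _:-_; :-_; con; _:=_)
  open TotalOrder totalOrder using (poset)
  open PartialOrderReasoning poset
  open ExtremaNonStrict _≤_ using (_≤⊤±; ⊥±≤_; [≤]-injective) renaming ([_] to [_]≤±)

  opaque

    -- The list holds only the first components of the indices. By `D-irr` the value of `f` depends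
    -- on that component alone, while `P` may still depend on the proof, so `em` decides whether
    -- some proof over the head satisfies it.
    argmin-list : {X : Set} {D : X → Set} → (∀ {x} (p q : D x) → p ≡ q) →
      (f : Σ X D → ℝ) (P : Σ X D → Set) (xs : List X) → ∃[ i ] P i × proj₁ i ∈ xs →
      ∃[ i ] P i × (∀ j → P j → proj₁ j ∈ xs → f i ≤ f j)
    argmin-list D-irr f P (x ∷ xs) (i , Pi , i∈x∷xs)
      with em {∃[ j ] P j × proj₁ j ∈ xs} | i∈x∷xs
    ... | no  none | there i∈xs    = contradiction (i , Pi , i∈xs) none
    ... | no  none | here ≡.refl   = i , Pi , λ where
      (_ , q) Pj (here ≡.refl) → ≤-reflexive (reflexive (≡.cong (λ p → f (_ , p)) (D-irr (proj₂ i) q)))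
      j       Pj (there j∈xs)  → contradiction (j , Pj , j∈xs) none
    ... | yes some | _
      with argmin-list D-irr f P xs some | em {∃[ p ] P (x , p)}
    ...   | k , Pk , k≤ | no ¬Px = k , Pk , λ where
      (_ , q) Pj (here ≡.refl) → contradiction (q , Pj) ¬Px
      j       Pj (there j∈xs)  → k≤ j Pj j∈xs
    ...   | k , Pk , k≤ | yes (p , Px) with total (f k) (f (x , p))
    ...     | inj₁ fk≤fx = k , Pk , λ where
      (_ , q) Pj (here ≡.refl) → ≤-trans fk≤fx (≤-reflexive (reflexive (≡.cong (λ p → f (_ , p)) (D-irr p q))))
      j       Pj (there j∈xs)  → k≤ j Pj j∈xs
    ...     | inj₂ fx≤fk = (x , p) , Px , λ where
      (_ , q) Pj (here ≡.refl) → ≤-reflexive (reflexive (≡.cong (λ p → f (_ , p)) (D-irr p q)))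
      j       Pj (there j∈xs)  → ≤-trans fx≤fk (k≤ j Pj j∈xs)

  interval : ℕ → List ℤ
  interval M = map +_ (upTo M) ++ map -[1+_] (upTo M)

  opaque

    ∈-interval : ∀ {m M} → ∣ fromℤ m ∣ < M · 1# → m ∈ interval M
    ∈-interval {+ k} {M} ∣m∣<M = ∈-++⁺ˡ (∈-map⁺ +_ (∈-upTo⁺
      (·1-cancel-< {k} {M} (≤-<-trans (x≤x⊔y _ _) ∣m∣<M))))
    ∈-interval { -[1+ k ] } {M} ∣m∣<M = ∈-++⁺ʳ (map +_ (upTo M)) (∈-map⁺ -[1+_] (∈-upTo⁺
      (ℕ.<-trans (ℕ.n<1+n k) (·1-cancel-< {suc k} {M} (begin-strict
        suc k · 1#                            ≈⟨ solve 1 (λ x → x := :- :- x) refl (suc k · 1#) ⟩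
        - - (suc k · 1#)                      ≤⟨ x≤y⊔x _ _ ⟩
        ∣ - (suc k · 1#) ∣                    <⟨ ∣m∣<M ⟩
        M · 1#                                ∎)))))

    fromℤ≈0⇒≡0 : ∀ {m} → fromℤ m ≈ 0# → m ≡ + 0
    fromℤ≈0⇒≡0 {m} m≈0 with 1≤∣fromℤ∣ m
    ... | inj₁ m≡0  = m≡0
    ... | inj₂ 1≤∣m∣ = contradiction (≤-trans 1≤∣m∣ (≤-reflexive (trans (∣∣-cong m≈0) (0≤x⇒∣x∣≈x ≤-refl)))) (<⇒≱ 0<1)

  -- Linear independence from irrationality

  opaque

    -- A relation with nonzero second coefficient n could be solved for the ratio, giving β/α =
    -- -m/n.
    irrational-independent-pos : ∀ {α β} → α ≉ 0# → Irrational (β / α) → ∀ m k →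
                                 α * fromℤ m + β * suc k · 1# ≉ 0#
    irrational-independent-pos {α} {β} α≉0 irrational m k αm+βn≈0 with fraction (ℤ.- m) (suc k)
    ... | q , qn≈-m = irrational q (*-cancelˡ-≈ (*-≉0 α≉0 (pos⇒≉0 (0<[1+n]·1 k))) (begin-equality
      α * n * (β / α)              ≈⟨ solve 3 (λ α n r → α :* n :* r := r :* α :* n) refl α n (β / α) ⟩
      β / α * α * n                ≈⟨ *-congʳ (x/y*y≈x β α≉0) ⟩
      β * n                        ≈⟨ solve 2 (λ x y → y := x :+ y :- x) refl (α * fromℤ m) (β * n) ⟩
      α * fromℤ m + β * n - α * fromℤ m
                                   ≈⟨ +-congʳ αm+βn≈0 ⟩
      0# - α * fromℤ m             ≈⟨ solve 2 (λ α m → con (+ 0) :- α :* m := α :* :- m) refl α (fromℤ m) ⟩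
      α * - fromℤ m                ≈⟨ *-congˡ (trans qn≈-m (fromℤ-homo‿- m)) ⟨
      α * (fromℚ q * n)            ≈⟨ solve 3 (λ α q n → α :* (q :* n) := α :* n :* q) refl α (fromℚ q) n ⟩
      α * n * fromℚ q              ∎))
      where
      n : ℝ
      n = suc k · 1#

  opaque

    irrational-independent : ∀ {α β} → α ≉ 0# → Irrational (β / α) → ∀ m n →
                             α * fromℤ m + β * fromℤ n ≈ 0# → m ≡ + 0 × n ≡ + 0
    irrational-independent {α} {β} α≉0 irrational m (+ zero) αm≈0 =
      fromℤ≈0⇒≡0 (*-cancelˡ-≈ α≉0 (begin-equality
        α * fromℤ m              ≈⟨ solve 3 (λ α β m → α :* m := α :* m :+ β :* con (+ 0)) refl α β (fromℤ m) ⟩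
        α * fromℤ m + β * 0#     ≈⟨ αm≈0 ⟩
        0#                       ≈⟨ zeroʳ α ⟨
        α * 0#                   ∎)) , ≡.refl
    irrational-independent α≉0 irrational m (+ suc k) αm+βn≈0 =
      contradiction αm+βn≈0 (irrational-independent-pos α≉0 irrational m k)
    irrational-independent {α} {β} α≉0 irrational m -[1+ k ] αm+βn≈0 =
      contradiction (begin-equality
        α * fromℤ (ℤ.- m) + β * suc k · 1#           ≈⟨ +-congʳ (*-congˡ (fromℤ-homo‿- m)) ⟩
        α * - fromℤ m + β * suc k · 1#               ≈⟨ solve 4 (λ α β m n → α :* :- m :+ β :* n := con (+ 0) :- (α :* m :+ β :* :- n)) refl α β (fromℤ m) (suc k · 1#) ⟩
        0# - (α * fromℤ m + β * - (suc k · 1#))      ≈⟨ +-congˡ (-‿cong αm+βn≈0) ⟩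
        0# - 0#                                      ≈⟨ -‿inverseʳ 0# ⟩
        0#                                           ∎)
        (irrational-independent-pos α≉0 irrational (ℤ.- m) k)

  -- Square roots and the arithmetic of exponents

  opaque

    sq-cancel-≤ : ∀ {x y} → 0# ≤ y → x * x ≤ y * y → x ≤ y
    sq-cancel-≤ {x} {y} 0≤y x²≤y² = ^-cancel-≤ 1 0≤y (begin
      x * (x * 1#)  ≈⟨ *-congˡ (*-identityʳ x) ⟩
      x * x         ≤⟨ x²≤y² ⟩
      y * y         ≈⟨ *-congˡ (*-identityʳ y) ⟨
      y * (y * 1#)  ∎)

    sq-mono-≤ : ∀ {x y} → 0# ≤ x → x ≤ y → x * x ≤ y * y
    sq-mono-≤ 0≤x x≤y = *-mono-≤ 0≤x (≤-trans 0≤x x≤y) x≤y x≤y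

  opaque

    √-mono-≤ : ∀ {x y} → 0# ≤ x → x ≤ y → √ x ≤ √ y
    √-mono-≤ {x} {y} 0≤x x≤y =
      let 0≤√x , √x²≈x = √-spec 0≤x
          0≤√y , √y²≈y = √-spec (≤-trans 0≤x x≤y)
      in sq-cancel-≤ 0≤√y (begin
        √ x * √ x  ≈⟨ √x²≈x ⟩
        x          ≤⟨ x≤y ⟩
        y          ≈⟨ √y²≈y ⟨
        √ y * √ y  ∎)

  opaque

    pos⇒↥≡+suc : ∀ q → 0# < fromℚ q → ∃[ k ] ↥ q ≡ + suc k
    pos⇒↥≡+suc q@(mkℚ (+ zero) _ _)   0<q = contradiction (zeroˡ _) (pos⇒≉0 0<q)
    pos⇒↥≡+suc q@(mkℚ (+ suc k) _ _)  0<q = k , ≡.refl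
    pos⇒↥≡+suc q@(mkℚ -[1+ k ] _ _)   0<q with nonNeg⇒↥≡+ q (proj₁ 0<q)
    ... | _ , ()

  opaque

    -- These choices give a/n = 2γ and c/n = 2β with the product of the denominators as common
    -- denominator n. The inequality between rationals is multiplied by 4n³.
    integer-exponents : ∀ β γ {k l} → ↥ β ≡ + k → ↥ γ ≡ + l →
      fromℚ β * fromℚ β < fromℚ γ * fromℚ γ + 2# * (fromℚ γ * fromℚ γ) * fromℚ β →
      let n = ↧ₙ γ ℕ.* ↧ₙ β; a = (l ℕ.+ l) ℕ.* ↧ₙ β; c = (k ℕ.+ k) ℕ.* ↧ₙ γ in
      c ℕ.* (n ℕ.* c) ℕ.< a ℕ.* (n ℕ.* a) ℕ.+ a ℕ.* (a ℕ.* c)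
    integer-exponents β γ {k} {l} ↥β≡k ↥γ≡l β²<γ²+2γ²β = ·1-cancel-< (begin-strict
      (c′ ℕ.* (n′ ℕ.* c′)) · 1#
        ≈⟨ trans (·1-homo-* c′ _) (*-cong c≈ (trans (·1-homo-* n′ c′) (*-cong (·1-homo-* (↧ₙ γ) (↧ₙ β)) c≈))) ⟩
      (B * P + B * P) * S * (S * P * ((B * P + B * P) * S))
        ≈⟨ solve 3 (λ B P S → (B :* P :+ B :* P) :* S :* (S :* P :* ((B :* P :+ B :* P) :* S))
             := con (+ 4) :* (P :* P :* P :* (S :* S :* S)) :* (B :* B)) refl B P S ⟩
      4# * (P * P * P * (S * S * S)) * (B * B)
        <⟨ *-monoʳ-< (*-pos 0<4 (*-pos (*-pos (*-pos 0<P 0<P) 0<P) (*-pos (*-pos 0<S 0<S) 0<S))) β²<γ²+2γ²β ⟩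
      4# * (P * P * P * (S * S * S)) * (G * G + 2# * (G * G) * B)
        ≈⟨ solve 4 (λ B G P S →
             (G :* S :+ G :* S) :* P :* (S :* P :* ((G :* S :+ G :* S) :* P)) :+
             (G :* S :+ G :* S) :* P :* ((G :* S :+ G :* S) :* P :* ((B :* P :+ B :* P) :* S))
             := con (+ 4) :* (P :* P :* P :* (S :* S :* S)) :* (G :* G :+ con (+ 2) :* (G :* G) :* B)) refl B G P S ⟨
      (G * S + G * S) * P * (S * P * ((G * S + G * S) * P)) +
      (G * S + G * S) * P * ((G * S + G * S) * P * ((B * P + B * P) * S))
        ≈⟨ trans (·-homo-+ 1# (a′ ℕ.* (n′ ℕ.* a′)) _) (+-cong
             (trans (·1-homo-* a′ _) (*-cong a≈ (trans (·1-homo-* n′ a′) (*-cong (·1-homo-* (↧ₙ γ) (↧ₙ β)) a≈))))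
             (trans (·1-homo-* a′ _) (*-cong a≈ (trans (·1-homo-* a′ c′) (*-cong a≈ c≈))))) ⟨
      (a′ ℕ.* (n′ ℕ.* a′) ℕ.+ a′ ℕ.* (a′ ℕ.* c′)) · 1#   ∎)
      where
      n′ a′ c′ : ℕ
      n′ = ↧ₙ γ ℕ.* ↧ₙ β
      a′ = (l ℕ.+ l) ℕ.* ↧ₙ β
      c′ = (k ℕ.+ k) ℕ.* ↧ₙ γ
      B G P S 4# : ℝ
      B = fromℚ β
      G = fromℚ γ
      P = ↧ₙ β · 1#
      S = ↧ₙ γ · 1#
      4# = 1# + 1# + 1# + 1#
      0<P : 0# < P
      0<P = 0<↧ β
      0<S : 0# < S
      0<S = 0<↧ γ
      0<4 : 0# < 4#
      0<4 = <-≤-trans 0<2 (≤-trans (proj₁ (x<x+y _ 0<1)) (proj₁ (x<x+y _ 0<1)))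
      doubled : ∀ q {j} → ↥ q ≡ + j → (j ℕ.+ j) · 1# ≈ fromℚ q * ↧ₙ q · 1# + fromℚ q * ↧ₙ q · 1#
      doubled q {j} ↥q≡j = trans (·-homo-+ 1# j j) (+-cong j≈ j≈)
        where
        j≈ : j · 1# ≈ fromℚ q * ↧ₙ q · 1#
        j≈ = sym (trans (fromℚ*↧≈↥ q) (reflexive (≡.cong fromℤ ↥q≡j)))
      c≈ : c′ · 1# ≈ (B * P + B * P) * S
      c≈ = trans (·1-homo-* (k ℕ.+ k) (↧ₙ γ)) (*-congʳ (doubled β ↥β≡k))
      a≈ : a′ · 1# ≈ (G * S + G * S) * P
      a≈ = trans (·1-homo-* (l ℕ.+ l) (↧ₙ β)) (*-congʳ (doubled γ ↥γ≡l))

  opaque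

    -- For `s` equal to r^(k/n) and `ψ` a value of `Ψ`, squaring replaces the roots by integer
    -- powers of the radius and of `ψ * ψ`, which is a value of `N`.
    square-power : ∀ {s r ψ} n k → s ^ n ≈ r ^ k →
                   (s * ψ) ^ n * (s * ψ) ^ n ≈ (ψ * ψ) ^ n * r ^ (k ℕ.+ k)
    square-power {s} {r} {ψ} n k sⁿ≈rᵏ = begin-equality
      (s * ψ) ^ n * (s * ψ) ^ n              ≈⟨ *-cong (^-distrib-* s ψ n) (^-distrib-* s ψ n) ⟩
      s ^ n * ψ ^ n * (s ^ n * ψ ^ n)        ≈⟨ *-cong (*-congʳ sⁿ≈rᵏ) (*-congʳ sⁿ≈rᵏ) ⟩
      r ^ k * ψ ^ n * (r ^ k * ψ ^ n)        ≈⟨ solve 2 (λ x y → x :* y :* (x :* y) := y :* y :* (x :* x)) refl (r ^ k) (ψ ^ n) ⟩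
      ψ ^ n * ψ ^ n * (r ^ k * r ^ k)        ≈⟨ *-cong (^-distrib-* ψ ψ n) (^-homo-* r k k) ⟨
      (ψ * ψ) ^ n * r ^ (k ℕ.+ k)            ∎

    power-product : ∀ u v n k m → (u ^ n * v ^ k) ^ m ≈ u ^ (n ℕ.* m) * v ^ (k ℕ.* m)
    power-product u v n k m = trans (^-distrib-* (u ^ n) (v ^ k) m) (*-cong (^-assocʳ u n m) (^-assocʳ v k m))

  opaque

    -- With z = 𝔊 y * y the defining equation of 𝔊 y reads z² = 2 y² z + y².
    below-𝔊 : ∀ {y g B} → 0# < y → 0# < g → 𝒢 y g ≈ 0# → 0# ≤ B → B < g * y →
              B * B < y * y * (1# + 2# * B)
    below-𝔊 {y} {g} {B} 0<y 0<g root 0≤B B<gy = *-cancelʳ-< (proj₁ 0<gy) (begin-strict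
      B * B * (g * y)
        ≈⟨ solve 2 (λ B z → B :* B :* z := z :* B :* B) refl B (g * y) ⟩
      g * y * B * B
        ≤⟨ *-monoʳ-≤ (*-nonNeg (proj₁ 0<gy) 0≤B) (proj₁ B<gy) ⟩
      g * y * B * (g * y)
        ≈⟨ solve 3 (λ g y B → g :* y :* B :* (g :* y)
             := (g :* (g :* con (+ 1)) :- con (+ 2) :* y :* g :- con (+ 1)) :* (y :* y :* B)
                :+ (con (+ 2) :* (g :* y) :* (y :* y :* B) :+ y :* y :* B)) refl g y B ⟩
      𝒢 y g * (y * y * B) + (2# * (g * y) * (y * y * B) + y * y * B)
        ≈⟨ trans (+-congʳ (trans (*-congʳ root) (zeroˡ _))) (+-identityˡ _) ⟩
      2# * (g * y) * (y * y * B) + y * y * B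
        <⟨ +-monoʳ-< _ (*-monoʳ-< (*-pos 0<y 0<y) B<gy) ⟩
      2# * (g * y) * (y * y * B) + y * y * (g * y)
        ≈⟨ solve 3 (λ z y B → con (+ 2) :* z :* (y :* y :* B) :+ y :* y :* z
             := y :* y :* (con (+ 1) :+ con (+ 2) :* B) :* z) refl (g * y) y B ⟩
      y * y * (1# + 2# * B) * (g * y) ∎)
      where
      0<gy : 0# < g * y
      0<gy = *-pos 0<g 0<y

  opaque

    -- The strict inequality at `y` persists slightly below `y`. The witness solves B² = x²(1 + 2B),
    -- the case of equality, and the right-hand side increases with `g`.
    threshold : ∀ {y B} → 0# ≤ y → 0# ≤ B → B * B < y * y * (1# + 2# * B) →
      ∃[ x ] 0# ≤ x × x < y × (∀ {g} → x < g → B * B < g * g + 2# * (g * g) * B)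
    threshold {y} {B} 0≤y 0≤B B²< = √ q , 0≤√q , ≰⇒> y≰√q , λ {g} √q<g → begin-strict
      B * B                         ≈⟨ x/y*y≈x (B * B) (pos⇒≉0 0<D) ⟨
      q * D                         ≈⟨ *-congʳ √q²≈q ⟨
      √ q * √ q * D                 <⟨ *-monoˡ-< 0<D (≤-<-trans (*-monoʳ-≤ 0≤√q (proj₁ √q<g)) (*-monoˡ-< (≤-<-trans 0≤√q √q<g) √q<g)) ⟩
      g * g * D                     ≈⟨ solve 2 (λ g B → g :* g :* (con (+ 1) :+ con (+ 2) :* B) := g :* g :+ con (+ 2) :* (g :* g) :* B) refl g B ⟩
      g * g + 2# * (g * g) * B      ∎
      where
      D q : ℝ
      D = 1# + 2# * B
      q = B * B / D
      0<D : 0# < D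
      0<D = <-≤-trans 0<1 (≤-trans (≤-reflexive (sym (+-identityʳ 1#))) (+-monoʳ-≤ 1# (*-nonNeg (proj₁ 0<2) 0≤B)))
      √q-spec : 0# ≤ √ q × √ q * √ q ≈ q
      √q-spec = √-spec (*-nonNeg (*-nonNeg 0≤B 0≤B) (proj₁ (⁻¹-pos 0<D)))
      0≤√q : 0# ≤ √ q
      0≤√q = proj₁ √q-spec
      √q²≈q : √ q * √ q ≈ q
      √q²≈q = proj₂ √q-spec
      y≰√q : ¬ y ≤ √ q
      y≰√q y≤√q = <⇒≱ B²< (begin
        y * y * D        ≤⟨ *-monoˡ-≤ (proj₁ 0<D) (sq-mono-≤ 0≤y y≤√q) ⟩
        √ q * √ q * D    ≈⟨ *-congʳ √q²≈q ⟩
        q * D            ≈⟨ x/y*y≈x (B * B) (pos⇒≉0 0<D) ⟩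
        B * B            ∎)

  -- From a transfer of exponents to the inequality of suprema

  module _ {Uniform Ordinary : ℝ → Set}
    (zero-exponent : Ordinary (fromℚ ℚ.0ℚ))
    (transfer : ∀ {γ′} → Uniform γ′ → ∀ β γ → 0# ≤ fromℚ β → 0# < fromℚ γ → fromℚ γ ≤ γ′ →
      fromℚ β * fromℚ β < fromℚ γ * fromℚ γ + 2# * (fromℚ γ * fromℚ γ) * fromℚ β →
      Ordinary (fromℚ β)) where

    opaque

      -- Written with `¬ s ≤± [ x ]` so that finite and infinite suprema are treated alike: some
      -- uniform exponent exceeds `x`, and a rational `γ` fits in between.
      ordinary-exponent : ∀ {s x} → IsLub _≤±_ (λ ((γ , _) : ∃ Uniform) → [ γ ]) s → 0# ≤ x → ¬ s ≤± [ x ] →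
        ∀ β → 0# ≤ fromℚ β →
        (∀ {g} → x < g → fromℚ β * fromℚ β < g * g + 2# * (g * g) * fromℚ β) →
        Ordinary (fromℚ β)
      ordinary-exponent s-lub 0≤x s≰x β 0≤β β²< with lub-above s-lub s≰x
      ... | γ′ , bounded , x<γ′ with ℚ-dense 0≤x x<γ′
      ...   | γ , x<γ , γ<γ′ = transfer bounded β γ 0≤β (≤-<-trans 0≤x x<γ) (proj₁ γ<γ′) (β²< x<γ)

    opaque

      0≤ω : ∀ {w} → IsLub _≤±_ (λ ((γ , _) : ∃ Ordinary) → [ γ ]) [ w ] → 0# ≤ w
      0≤ω w-lub = ≤-respˡ-≈ (zeroˡ _) ([≤]-injective (proj₁ w-lub (fromℚ ℚ.0ℚ , zero-exponent)))

    opaque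

      -- Were `w` smaller, a rational `β` strictly between `w` and `𝔊 y * y` would be an ordinary
      -- exponent above their supremum. When `𝔊 y` is the default or `y ≤ 0#`, the product is at
      -- most `0#` and `0≤ω` suffices.
      finite-case : ∀ {y w} → IsLub _≤±_ (λ ((γ , _) : ∃ Uniform) → [ γ ]) [ y ] →
                    IsLub _≤±_ (λ ((γ , _) : ∃ Ordinary) → [ γ ]) [ w ] → 𝔊 y * y ≤ w
      finite-case {y} {w} y-lub w-lub with ≤-<-total (𝔊 y * y) w
      ... | inj₁ ≤w = ≤w
      ... | inj₂ w<𝔊y*y with choose-cases 0# (λ g → 0# < g × 𝒢 y g ≈ 0#)
      ...   | inj₂ 𝔊y≡0 = contradiction (0≤ω w-lub) (<⇒≱ (<-≤-trans w<𝔊y*y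
                (≤-reflexive (trans (*-congʳ (reflexive 𝔊y≡0)) (zeroˡ y)))))
      ...   | inj₁ (0<𝔊y , root) with ≤-<-total y 0#
      ...     | inj₁ y≤0 = contradiction (0≤ω w-lub) (<⇒≱ (<-≤-trans w<𝔊y*y
                  (≤-trans (*-monoʳ-≤ (proj₁ 0<𝔊y) y≤0) (≤-reflexive (zeroʳ _)))))
      ...     | inj₂ 0<y with ℚ-dense (0≤ω w-lub) w<𝔊y*y
      ...       | β , w<β , β<𝔊y*y with ≤-trans (0≤ω w-lub) (proj₁ w<β)
      ...         | 0≤β with threshold (proj₁ 0<y) 0≤β (below-𝔊 0<y 0<𝔊y root 0≤β β<𝔊y*y)
      ...           | x , 0≤x , x<y , β²< = contradiction
                        ([≤]-injective (proj₁ w-lub (fromℚ β ,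
                          ordinary-exponent y-lub 0≤x (<⇒≱ x<y ∘ [≤]-injective) β 0≤β β²<)))
                        (<⇒≱ w<β)

    opaque

      infinite-case : ∀ {w} → IsLub _≤±_ (λ ((γ , _) : ∃ Uniform) → [ γ ]) ⊤± →
                      ¬ IsLub _≤±_ (λ ((γ , _) : ∃ Ordinary) → [ γ ]) [ w ]
      infinite-case {w} ⊤-lub w-lub with ℚ-dense (0≤ω w-lub) (x<x+y w 0<1)
      ... | β , w<β , _ = <⇒≱ w<β ([≤]-injective (proj₁ w-lub (fromℚ β ,
              ordinary-exponent ⊤-lub 0≤β (λ ()) β 0≤β β²<)))
        where
        0≤β : 0# ≤ fromℚ β
        0≤β = ≤-trans (0≤ω w-lub) (proj₁ w<β)
        β²< : ∀ {g} → fromℚ β < g → fromℚ β * fromℚ β < g * g + 2# * (g * g) * fromℚ β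
        β²< {g} β<g = begin-strict
          fromℚ β * fromℚ β                  ≤⟨ *-monoʳ-≤ 0≤β (proj₁ β<g) ⟩
          fromℚ β * g                        <⟨ *-monoˡ-< (≤-<-trans 0≤β β<g) β<g ⟩
          g * g                              ≈⟨ +-identityʳ _ ⟨
          g * g + 0#                         ≤⟨ +-monoʳ-≤ _ (*-nonNeg (*-nonNeg (proj₁ 0<2) (*-nonNeg 0≤g 0≤g)) 0≤β) ⟩
          g * g + 2# * (g * g) * fromℚ β     ∎
          where
          0≤g : 0# ≤ g
          0≤g = ≤-trans 0≤β (proj₁ β<g)

    opaque

      𝔊*-≤ : ∀ y w → IsLub _≤±_ (λ ((γ , _) : ∃ Uniform) → [ γ ]) y →
             IsLub _≤±_ (λ ((γ , _) : ∃ Ordinary) → [ γ ]) w → 𝔊[ y ]* ≤± w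
      𝔊*-≤ y     ⊤±    y-lub w-lub = _ ≤⊤±
      𝔊*-≤ y     ⊥±    y-lub w-lub = contradiction (proj₁ w-lub (fromℚ ℚ.0ℚ , zero-exponent)) [x]≰⊥±
      𝔊*-≤ ⊥±    [ w ] y-lub w-lub = ⊥±≤ [ w ]
      𝔊*-≤ [ y ] [ w ] y-lub w-lub = [ finite-case y-lub w-lub ]≤±
      𝔊*-≤ ⊤±    [ w ] y-lub w-lub = contradiction w-lub (infinite-case y-lub)

  -- The points of a lattice in integer coordinates

  module _ (A : Matrix) (detA≉0 : det A ≉ 0#)
    (A₀₀≉0 : A 0F 0F ≉ 0#) (A₁₁≉0 : A 1F 1F ≉ 0#)
    (θ-irrational : Irrational (A 0F 1F / A 0F 0F))
    (η-irrational : Irrational (A 1F 0F / A 1F 1F)) where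

    private
      a b c e : ℝ
      a = A 0F 0F
      b = A 0F 1F
      c = A 1F 0F
      e = A 1F 1F

      Λ = A ℤ²

      NonZero : ℤ × ℤ → Set
      NonZero (m , n) = ¬ (m ≡ + 0 × n ≡ + 0)

      I : Set
      I = Σ (ℤ × ℤ) NonZero

      X Y x y t N : I → ℝ
      X ((m , n) , _) = a * fromℤ m + b * fromℤ n
      Y ((m , n) , _) = c * fromℤ m + e * fromℤ n
      x i = ∣ X i ∣
      y i = ∣ Y i ∣
      t i = x i ⊔ y i
      N i = x i * y i

    opaque

      0<x : ∀ i → 0# < x i
      0<x ((m , n) , nonZero) = x≉0⇒0<∣x∣ (nonZero ∘ irrational-independent A₀₀≉0 θ-irrational m n)

      0<y : ∀ i → 0# < y i
      0<y ((m , n) , nonZero) = x≉0⇒0<∣x∣ λ Y≈0 →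
        let n≡0 , m≡0 = irrational-independent A₁₁≉0 η-irrational n m (trans (+-comm _ _) Y≈0)
        in nonZero (m≡0 , n≡0)

    private
      cross : I → I → ℤ
      cross ((m , n) , _) ((m′ , n′) , _) = m ℤ.* n′ ℤ.- m′ ℤ.* n

    opaque

      determinant : ∀ i j → X i * Y j - X j * Y i ≈ det A * fromℤ (cross i j)
      determinant i@((m , n) , _) j@((m′ , n′) , _) = begin-equality
        X i * Y j - X j * Y i
          ≈⟨ solve 8 (λ a b c e m n m′ n′ →
               (a :* m :+ b :* n) :* (c :* m′ :+ e :* n′) :- (a :* m′ :+ b :* n′) :* (c :* m :+ e :* n)
               := (a :* e :- b :* c) :* (m :* n′ :- m′ :* n))
             refl a b c e (fromℤ m) (fromℤ n) (fromℤ m′) (fromℤ n′) ⟩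
        det A * (fromℤ m * fromℤ n′ - fromℤ m′ * fromℤ n)
          ≈⟨ *-congˡ (+-cong (fromℤ-homo-* m n′) (-‿cong (fromℤ-homo-* m′ n))) ⟨
        det A * (fromℤ (m ℤ.* n′) - fromℤ (m′ ℤ.* n))
          ≈⟨ *-congˡ (trans (fromℤ-homo-+ (m ℤ.* n′) _) (+-congˡ (fromℤ-homo‿- (m′ ℤ.* n)))) ⟨
        det A * fromℤ (cross i j) ∎

    opaque

      -- The determinant of two lattice points is `det A` times an integer. Passing to absolute
      -- values, the vanishing case keeps only an equality of products, which is all that
      -- `same-axis` uses of parallelism.
      separated : ∀ i j → x i * y j ≈ x j * y i ⊎ ∣ det A ∣ ≤ x i * y j + x j * y i
      separated i j with 1≤∣fromℤ∣ (cross i j)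
      ... | inj₁ z≡0 = inj₁ (begin-equality
        x i * y j       ≈⟨ ∣x*y∣≈∣x∣*∣y∣ (X i) (Y j) ⟨
        ∣ X i * Y j ∣   ≈⟨ ∣∣-cong (begin-equality
          X i * Y j                             ≈⟨ solve 2 (λ p q → p := q :+ (p :- q)) refl (X i * Y j) (X j * Y i) ⟩
          X j * Y i + (X i * Y j - X j * Y i)   ≈⟨ +-congˡ (trans (determinant i j) (*-congˡ (reflexive (≡.cong fromℤ z≡0)))) ⟩
          X j * Y i + det A * 0#                ≈⟨ solve 2 (λ p q → p :+ q :* con (+ 0) := p) refl (X j * Y i) (det A) ⟩
          X j * Y i                             ∎) ⟩
        ∣ X j * Y i ∣   ≈⟨ ∣x*y∣≈∣x∣*∣y∣ (X j) (Y i) ⟩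
        x j * y i       ∎)
      ... | inj₂ 1≤∣z∣ = inj₂ (begin
        ∣ det A ∣                            ≈⟨ *-identityʳ _ ⟨
        ∣ det A ∣ * 1#                       ≤⟨ *-monoʳ-≤ (0≤∣x∣ _) 1≤∣z∣ ⟩
        ∣ det A ∣ * ∣ fromℤ (cross i j) ∣    ≈⟨ ∣x*y∣≈∣x∣*∣y∣ _ _ ⟨
        ∣ det A * fromℤ (cross i j) ∣        ≈⟨ ∣∣-cong (determinant i j) ⟨
        ∣ X i * Y j - X j * Y i ∣            ≤⟨ ∣x-y∣≤∣x∣+∣y∣ _ _ ⟩
        ∣ X i * Y j ∣ + ∣ X j * Y i ∣        ≈⟨ +-cong (∣x*y∣≈∣x∣*∣y∣ _ _) (∣x*y∣≈∣x∣*∣y∣ _ _) ⟩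
        x i * y j + x j * y i                ∎)

    opaque

      ∣det∣*∣z∣-bound : ∀ {z p q u v r} → det A * z ≈ p * u - q * v → ∣ u ∣ ≤ r → ∣ v ∣ ≤ r →
                        ∣ det A ∣ * ∣ z ∣ ≤ (∣ p ∣ + ∣ q ∣) * r
      ∣det∣*∣z∣-bound {z} {p} {q} {u} {v} {r} cramer u≤r v≤r = begin
        ∣ det A ∣ * ∣ z ∣                ≈⟨ ∣x*y∣≈∣x∣*∣y∣ _ _ ⟨
        ∣ det A * z ∣                    ≈⟨ ∣∣-cong cramer ⟩
        ∣ p * u - q * v ∣                ≤⟨ ∣x-y∣≤∣x∣+∣y∣ _ _ ⟩
        ∣ p * u ∣ + ∣ q * v ∣            ≈⟨ +-cong (∣x*y∣≈∣x∣*∣y∣ p u) (∣x*y∣≈∣x∣*∣y∣ q v) ⟩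
        ∣ p ∣ * ∣ u ∣ + ∣ q ∣ * ∣ v ∣    ≤⟨ +-mono-≤ (*-monoʳ-≤ (0≤∣x∣ p) u≤r) (*-monoʳ-≤ (0≤∣x∣ q) v≤r) ⟩
        ∣ p ∣ * r + ∣ q ∣ * r            ≈⟨ distribʳ r _ _ ⟨
        (∣ p ∣ + ∣ q ∣) * r              ∎

      bounded-coordinate : ∀ {z p q u v r} → det A * z ≈ p * u - q * v → ∣ u ∣ ≤ r → ∣ v ∣ ≤ r →
                           ∀ {k} → (∣ p ∣ + ∣ q ∣) * r / ∣ det A ∣ < k → ∣ z ∣ < k
      bounded-coordinate {z} {p} {q} {r = r} cramer u≤r v≤r <k = ≤-<-trans (*-cancelˡ-≤ 0<∣det∣ (begin
        ∣ det A ∣ * ∣ z ∣                                ≤⟨ ∣det∣*∣z∣-bound cramer u≤r v≤r ⟩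
        (∣ p ∣ + ∣ q ∣) * r                              ≈⟨ x/y*y≈x _ (pos⇒≉0 0<∣det∣) ⟨
        (∣ p ∣ + ∣ q ∣) * r / ∣ det A ∣ * ∣ det A ∣      ≈⟨ *-comm _ _ ⟩
        ∣ det A ∣ * ((∣ p ∣ + ∣ q ∣) * r / ∣ det A ∣)    ∎)) <k
        where
        0<∣det∣ : 0# < ∣ det A ∣
        0<∣det∣ = x≉0⇒0<∣x∣ detA≉0

      -- Cramer's rule expresses each integer coordinate through the two real ones, so a ball lies
      -- in a finite box of integer pairs.
      box : ∀ r → ∃[ xs ] (∀ i → t i ≤ r → proj₁ i ∈ xs)
      box r with archimedean ((∣ e ∣ + ∣ b ∣) * r / ∣ det A ∣) | archimedean ((∣ a ∣ + ∣ c ∣) * r / ∣ det A ∣)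
      ... | M₁ , <M₁ | M₂ , <M₂ = cartesianProduct (interval M₁) (interval M₂) , λ where
        i@((m , n) , _) tᵢ≤r → ∈-cartesianProduct⁺
          (∈-interval {M = M₁} (bounded-coordinate
            (solve 6 (λ a b c e m n →
               (a :* e :- b :* c) :* m := e :* (a :* m :+ b :* n) :- b :* (c :* m :+ e :* n))
             refl a b c e (fromℤ m) (fromℤ n))
            (≤-trans (x≤x⊔y (x i) (y i)) tᵢ≤r) (≤-trans (x≤y⊔x (x i) (y i)) tᵢ≤r) <M₁))
          (∈-interval {M = M₂} (bounded-coordinate
            (solve 6 (λ a b c e m n →
               (a :* e :- b :* c) :* n := a :* (c :* m :+ e :* n) :- c :* (a :* m :+ b :* n))
             refl a b c e (fromℤ m) (fromℤ n))
            (≤-trans (x≤y⊔x (x i) (y i)) tᵢ≤r) (≤-trans (x≤x⊔y (x i) (y i)) tᵢ≤r) <M₂))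

    opaque

      argmin : ∀ (f : I → ℝ) (P : I → Set) r → ∃[ i ] P i × t i ≤ r →
               ∃[ i ] (P i × t i ≤ r) × (∀ j → P j → t j ≤ r → f i ≤ f j)
      argmin f P r (i , Pi , tᵢ≤r) with box r
      -- Proofs of a negation are definitionally equal, so `NonZero` is irrelevant by `≡.refl`.
      ... | xs , ∈xs with argmin-list (λ _ _ → ≡.refl) f (λ j → P j × t j ≤ r) xs (i , (Pi , tᵢ≤r) , ∈xs i tᵢ≤r)
      ...   | k , Pk , k≤ = k , Pk , λ j Pj tⱼ≤r → k≤ j (Pj , tⱼ≤r) (∈xs j tⱼ≤r)

    -- The function Ψ as an attained minimum

    private
      Ball : ℝ → Set
      Ball r = ∃[ v ] Λ v × 0# < ‖ v ‖ × ‖ v ‖ ≤ r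

      height : ∀ {r} → Ball r → ℝ
      height ((x₁ , x₂) , _) = √ ∣ x₁ * x₂ ∣

      toBall : ∀ i {r} → t i ≤ r → Ball r
      toBall i@((m , n) , _) tᵢ≤r =
        (X i , Y i) , (m , n , refl , refl) , <-≤-trans (0<x i) (x≤x⊔y (x i) (y i)) , tᵢ≤r

    opaque

      -- Points in the definition of `Ψ` satisfy the lattice equations only up to `≈`; their integer
      -- pair is nonzero because the zero pair would have norm zero.
      fromBall : ∀ {r} (((x₁ , x₂) , _) : Ball r) → ∃[ i ] t i ≤ r × N i ≈ ∣ x₁ * x₂ ∣
      fromBall {r} ((x₁ , x₂) , (m , n , x₁≈X , x₂≈Y) , 0<‖x‖ , ‖x‖≤r) =
        i , ≤-respˡ-≈ (⊔-cong (∣∣-cong x₁≈X) (∣∣-cong x₂≈Y)) ‖x‖≤r , (begin-equality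
          ∣ X i ∣ * ∣ Y i ∣   ≈⟨ ∣x*y∣≈∣x∣*∣y∣ _ _ ⟨
          ∣ X i * Y i ∣       ≈⟨ ∣∣-cong (*-cong x₁≈X x₂≈Y) ⟨
          ∣ x₁ * x₂ ∣         ∎)
        where
        ∣∣≤0 : ∀ {z p q} → z ≈ p * fromℤ m + q * fromℤ n → m ≡ + 0 → n ≡ + 0 → ∣ z ∣ ≤ 0#
        ∣∣≤0 {z} {p} {q} z≈ ≡.refl ≡.refl = ≤-reflexive (trans (∣∣-cong (begin-equality
          z                  ≈⟨ z≈ ⟩
          p * 0# + q * 0#    ≈⟨ solve 2 (λ p q → p :* con (+ 0) :+ q :* con (+ 0) := con (+ 0)) refl p q ⟩
          0#                 ∎)) (0≤x⇒∣x∣≈x ≤-refl))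
        i : I
        i = (m , n) , λ (m≡0 , n≡0) → <⇒≱ 0<‖x‖ (⊔-lub (∣∣≤0 x₁≈X m≡0 n≡0) (∣∣≤0 x₂≈Y m≡0 n≡0))

    opaque

      0≤N : ∀ i → 0# ≤ N i
      0≤N i = *-nonNeg (0≤∣x∣ (X i)) (0≤∣x∣ (Y i))

    opaque

      -- `min` returns its default unless a minimum is attained. An `argmin` of `N` attains it,
      -- since the square root is monotone.
      Ψ-min : ∀ {r} → ∃[ i ] t i ≤ r →
              (∃[ p ] Ψ Λ r ≈ height {r} p) × (∀ p → Ψ Λ r ≤ height {r} p)
      Ψ-min {r} (i , tᵢ≤r) with argmin N (λ _ → ⊤) r (i , tt , tᵢ≤r)
      ... | k , (_ , tₖ≤r) , Nₖ≤ = choose-spec 0# IsMin (height (toBall k tₖ≤r) , (toBall k tₖ≤r , refl) , minimal)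
        where
        IsMin : ℝ → Set
        IsMin m = (∃[ p ] m ≈ height {r} p) × (∀ p → m ≤ height {r} p)
        minimal : ∀ p → height (toBall k tₖ≤r) ≤ height {r} p
        minimal p@((x₁ , x₂) , _) with fromBall p
        ... | j , tⱼ≤r , Nⱼ≈ = √-mono-≤ (0≤∣x∣ _) (begin
          ∣ X k * Y k ∣   ≈⟨ ∣x*y∣≈∣x∣*∣y∣ _ _ ⟩
          N k             ≤⟨ Nₖ≤ j tt tⱼ≤r ⟩
          N j             ≈⟨ Nⱼ≈ ⟩
          ∣ x₁ * x₂ ∣     ∎)

    opaque

      Ψ-attained : ∀ {r} → ∃[ i ] t i ≤ r →
                   0# ≤ Ψ Λ r × (∃[ i ] t i ≤ r × N i ≈ Ψ Λ r * Ψ Λ r)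
      Ψ-attained {r} i with Ψ-min i
      ... | (p@((x₁ , x₂) , _) , Ψ≈) , _ with fromBall p | √-spec (0≤∣x∣ (x₁ * x₂))
      ...   | k , tₖ≤r , Nₖ≈ | 0≤√ , √²≈ = ≤-respʳ-≈ (sym Ψ≈) 0≤√ , k , tₖ≤r , (begin-equality
        N k                                      ≈⟨ Nₖ≈ ⟩
        ∣ x₁ * x₂ ∣                              ≈⟨ √²≈ ⟨
        √ ∣ x₁ * x₂ ∣ * √ ∣ x₁ * x₂ ∣            ≈⟨ *-cong Ψ≈ Ψ≈ ⟨
        Ψ Λ r * Ψ Λ r                            ∎)

      Ψ-lower : ∀ i {r} → t i ≤ r → Ψ Λ r ≤ √ ∣ X i * Y i ∣
      Ψ-lower i tᵢ≤r = proj₂ (Ψ-min (i , tᵢ≤r)) (toBall i tᵢ≤r)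

    opaque

      Ψ²≤N : ∀ i → Ψ Λ (t i) * Ψ Λ (t i) ≤ N i
      Ψ²≤N i with √-spec (0≤∣x∣ (X i * Y i))
      ... | _ , √²≈ = begin
        Ψ Λ (t i) * Ψ Λ (t i)                    ≤⟨ sq-mono-≤ (proj₁ (Ψ-attained (i , ≤-refl))) (Ψ-lower i ≤-refl) ⟩
        √ ∣ X i * Y i ∣ * √ ∣ X i * Y i ∣        ≈⟨ √²≈ ⟩
        ∣ X i * Y i ∣                            ≈⟨ ∣x*y∣≈∣x∣*∣y∣ _ _ ⟩
        N i                                      ∎

    -- Transfer from the uniform to the ordinary exponent

    private
      -- A fixed nonzero point, so that balls of radius at least `t i₀` are inhabited and `Ψ` is a
      -- genuine minimum there.
      i₀ : I
      i₀ = (+ 1 , + 0) , λ ()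

      weighted : ℝ → ℝ → ℝ
      weighted γ r = r ^ʳ γ * Ψ Λ r

    opaque

      -- The lower bound on the weighted minimum is read at the radius of the point itself, where Ψ²
      -- is at most `N i`. The radius is kept above `1#` so that its real and rational powers
      -- compare.
      eventually-large : ∀ q {k} → ↥ q ≡ + k → ¬ liminf (weighted (fromℚ q)) <± ⊤± →
        ∃[ T ] (∀ i → T ≤ t i → 1# ≤ N i ^ ↧ₙ q * t i ^ (k ℕ.+ k))
      eventually-large q {k} ↥q≡k liminf≮⊤ =
        let T , 1<w = liminf≮⊤⇒eventually-large liminf≮⊤ 1# in T ⊔ 1# , λ i T⊔1≤tᵢ →
        let 1≤tᵢ = ≤-trans (x≤y⊔x T 1#) T⊔1≤tᵢ
            r = t i
            ψ = Ψ Λ r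
            0≤ψ = proj₁ (Ψ-attained (i , ≤-refl))
            1≤rqψ = begin
              1#                      ≤⟨ proj₁ (1<w r (≤-trans (x≤x⊔y T 1#) T⊔1≤tᵢ)) ⟩
              r ^ʳ fromℚ q * ψ        ≤⟨ *-monoˡ-≤ 0≤ψ (^ʳ≤^ᵠ 1≤tᵢ q ↥q≡k) ⟩
              r ^ᵠ q * ψ              ∎
            1≤p = 1≤x⇒1≤x^n (↧ₙ q) 1≤rqψ
        in begin
          1#                                              ≈⟨ *-identityˡ 1# ⟨
          1# * 1#                                         ≤⟨ sq-mono-≤ 0≤1 1≤p ⟩
          (r ^ᵠ q * ψ) ^ ↧ₙ q * (r ^ᵠ q * ψ) ^ ↧ₙ q       ≈⟨ square-power (↧ₙ q) k (proj₂ (^ᵠ-spec 1≤tᵢ q ↥q≡k)) ⟩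
          (ψ * ψ) ^ ↧ₙ q * r ^ (k ℕ.+ k)                  ≤⟨ *-monoˡ-≤ (^-nonNeg (≤-trans 0≤1 1≤tᵢ) (k ℕ.+ k))
                                                               (^-mono-≤ (↧ₙ q) (*-nonNeg 0≤ψ 0≤ψ) (Ψ²≤N i)) ⟩
          N i ^ ↧ₙ q * r ^ (k ℕ.+ k)                      ∎

    opaque

      eventually-small : ∀ {γ} q {k} → ↥ q ≡ + k → fromℚ q ≤ γ → limsup (weighted γ) <± ⊤± →
        ∃[ T ] ∃[ C ] 0# ≤ C ×
        (∀ r → T ≤ r → 1# ≤ r × (∃[ i ] t i ≤ r × N i ^ ↧ₙ q * r ^ (k ℕ.+ k) ≤ C))
      eventually-small {γ} q {k} ↥q≡k q≤γ limsup<⊤ with limsup<⊤⇒bounded limsup<⊤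
      ... | T , C , w≤C = T ⊔ (1# ⊔ t i₀) , C′ ^ ↧ₙ q * C′ ^ ↧ₙ q , *-nonNeg 0≤C′ⁿ 0≤C′ⁿ , λ r T′≤r →
        let 1⊔t₀≤r = ≤-trans (x≤y⊔x T _) T′≤r
            1≤r = ≤-trans (x≤x⊔y 1# (t i₀)) 1⊔t₀≤r
            ψ = Ψ Λ r
            0≤ψ , i , tᵢ≤r , Nᵢ≈ψ² = Ψ-attained (i₀ , ≤-trans (x≤y⊔x 1# (t i₀)) 1⊔t₀≤r)
            0<rq , rqⁿ≈ = ^ᵠ-spec 1≤r q ↥q≡k
            0≤rqψ = *-nonNeg (proj₁ 0<rq) 0≤ψ
            rqψ≤C′ = begin
              r ^ᵠ q * ψ    ≤⟨ *-monoˡ-≤ 0≤ψ (^ᵠ≤^ʳ 1≤r q q≤γ) ⟩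
              r ^ʳ γ * ψ    ≤⟨ w≤C r (≤-trans (x≤x⊔y T _) T′≤r) ⟩
              C             ≤⟨ x≤x⊔y C 0# ⟩
              C′            ∎
        in 1≤r , i , tᵢ≤r , (begin
          N i ^ ↧ₙ q * r ^ (k ℕ.+ k)                      ≈⟨ *-congʳ (^-congˡ (↧ₙ q) Nᵢ≈ψ²) ⟩
          (ψ * ψ) ^ ↧ₙ q * r ^ (k ℕ.+ k)                  ≈⟨ square-power (↧ₙ q) k rqⁿ≈ ⟨
          (r ^ᵠ q * ψ) ^ ↧ₙ q * (r ^ᵠ q * ψ) ^ ↧ₙ q       ≤⟨ sq-mono-≤ (^-nonNeg 0≤rqψ (↧ₙ q)) (^-mono-≤ (↧ₙ q) 0≤rqψ rqψ≤C′) ⟩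
          C′ ^ ↧ₙ q * C′ ^ ↧ₙ q                           ∎)
        where
        C′ : ℝ
        -- Taking the maximum with `0#` makes the constant visibly nonnegative, as its powers must
        -- be.
        C′ = C ⊔ 0#
        0≤C′ⁿ : 0# ≤ C′ ^ ↧ₙ q
        0≤C′ⁿ = ^-nonNeg (x≤y⊔x C 0#) (↧ₙ q)

    opaque

      -- If `β` failed, both bounds would hold at once. Raising each to the denominator of the other
      -- exponent gives `N` the same power in both, as the argument on minimal points requires.
      transfer-pos : ∀ {γ′} → limsup (weighted γ′) <± ⊤± → ∀ β γ {k l} → ↥ β ≡ + k → ↥ γ ≡ + suc l → fromℚ γ ≤ γ′ →
        fromℚ β * fromℚ β < fromℚ γ * fromℚ γ + 2# * (fromℚ γ * fromℚ γ) * fromℚ β →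
        ¬ ¬ liminf (weighted (fromℚ β)) <± ⊤±
      transfer-pos limsup<⊤ β@(mkℚ _ p _) γ@(mkℚ _ s _) {k} {l} ↥β≡k ↥γ≡1+l γ≤γ′ β²<γ²+2γ²β liminf≮⊤
        with eventually-small γ ↥γ≡1+l γ≤γ′ limsup<⊤ | eventually-large β ↥β≡k liminf≮⊤
      ... | T₁ , C , 0≤C , small | T₂ , large = uniform-ordinary-absurd x y 0<x 0<y (x≉0⇒0<∣x∣ detA≉0) separated argmin
            -- The first two arguments are predecessors: their successors are definitionally
            -- `suc s ℕ.* suc p` and `(suc l ℕ.+ suc l) ℕ.* suc p`.
            (p ℕ.+ s ℕ.* suc p) (p ℕ.+ (l ℕ.+ suc l) ℕ.* suc p) ((k ℕ.+ k) ℕ.* suc s) {T₁ ⊔ T₂} {C ^ suc p}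
            (^-nonNeg 0≤C (suc p)) (integer-exponents β γ ↥β≡k ↥γ≡1+l β²<γ²+2γ²β) uniform ordinary
        where
        uniform : ∀ r → T₁ ⊔ T₂ ≤ r →
          ∃[ i ] t i ≤ r × N i ^ (suc s ℕ.* suc p) * r ^ ((suc l ℕ.+ suc l) ℕ.* suc p) ≤ C ^ suc p
        uniform r T≤r with small r (≤-trans (x≤x⊔y T₁ T₂) T≤r)
        ... | 1≤r , i , tᵢ≤r , Nr≤C = i , tᵢ≤r , (begin
          N i ^ (suc s ℕ.* suc p) * r ^ ((suc l ℕ.+ suc l) ℕ.* suc p)  ≈⟨ power-product (N i) r (suc s) (suc l ℕ.+ suc l) (suc p) ⟨
          (N i ^ suc s * r ^ (suc l ℕ.+ suc l)) ^ suc p                ≤⟨ ^-mono-≤ (suc p) (*-nonNeg (^-nonNeg (0≤N i) (suc s))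
                                                                            (^-nonNeg (≤-trans 0≤1 1≤r) (suc l ℕ.+ suc l))) Nr≤C ⟩
          C ^ suc p                                                    ∎)
        ordinary : ∀ i → T₁ ⊔ T₂ ≤ t i →
          1# ≤ N i ^ (suc s ℕ.* suc p) * t i ^ ((k ℕ.+ k) ℕ.* suc s)
        ordinary i T≤tᵢ = begin
          1#                                                       ≤⟨ 1≤x⇒1≤x^n (suc s) (large i (≤-trans (x≤y⊔x T₁ T₂) T≤tᵢ)) ⟩
          (N i ^ suc p * t i ^ (k ℕ.+ k)) ^ suc s                  ≈⟨ power-product (N i) (t i) (suc p) (k ℕ.+ k) (suc s) ⟩
          N i ^ (suc p ℕ.* suc s) * t i ^ ((k ℕ.+ k) ℕ.* suc s)    ≈⟨ *-congʳ (^-congʳ (N i) (ℕ.*-comm (suc p) (suc s))) ⟩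
          N i ^ (suc s ℕ.* suc p) * t i ^ ((k ℕ.+ k) ℕ.* suc s)    ∎

    opaque

      transfer : ∀ {γ′} → limsup (weighted γ′) <± ⊤± → ∀ β γ → 0# ≤ fromℚ β → 0# < fromℚ γ → fromℚ γ ≤ γ′ →
        fromℚ β * fromℚ β < fromℚ γ * fromℚ γ + 2# * (fromℚ γ * fromℚ γ) * fromℚ β →
        liminf (weighted (fromℚ β)) <± ⊤±
      transfer limsup<⊤ β γ 0≤β 0<γ γ≤γ′ β²<γ²+2γ²β =
        let k , ↥β≡k = nonNeg⇒↥≡+ β 0≤β
            l , ↥γ≡1+l = pos⇒↥≡+suc γ 0<γ
        in ¬¬-elim (transfer-pos limsup<⊤ β γ ↥β≡k ↥γ≡1+l γ≤γ′ β²<γ²+2γ²β)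

    opaque

      -- Makes the ordinary exponent nonnegative. The weight is at most one, and `Ψ` never exceeds
      -- the value at the fixed point `i₀`, which supplies the constant.
      zero-exponent : liminf (weighted (fromℚ ℚ.0ℚ)) <± ⊤±
      zero-exponent = frequentlyBounded⇒liminf<⊤ {K = √ ∣ X i₀ * Y i₀ ∣} λ T →
        let r = T ⊔ (1# ⊔ t i₀)
            1⊔t₀≤r = x≤y⊔x T (1# ⊔ t i₀)
            1≤r = ≤-trans (x≤x⊔y 1# (t i₀)) 1⊔t₀≤r
            t₀≤r = ≤-trans (x≤y⊔x 1# (t i₀)) 1⊔t₀≤r
            ψ = Ψ Λ r
            0≤ψ = proj₁ (Ψ-attained (i₀ , t₀≤r))
        in r , x≤x⊔y T _ , (begin
          r ^ʳ fromℚ ℚ.0ℚ * ψ     ≤⟨ *-monoˡ-≤ 0≤ψ (^ʳ≤^ᵠ 1≤r ℚ.0ℚ ≡.refl) ⟩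
          r ^ᵠ ℚ.0ℚ * ψ           ≈⟨ *-congʳ (trans (sym (*-identityʳ _)) (proj₂ (^ᵠ-spec 1≤r ℚ.0ℚ ≡.refl))) ⟩
          1# * ψ                  ≈⟨ *-identityˡ ψ ⟩
          ψ                       ≤⟨ Ψ-lower i₀ t₀≤r ⟩
          √ ∣ X i₀ * Y i₀ ∣       ∎)

    opaque

      𝔊[ω̄]*≤ω : 𝔊[ ω̄ Λ ]* ≤± ω Λ
      𝔊[ω̄]*≤ω = 𝔊*-≤ zero-exponent transfer (ω̄ Λ) (ω Λ) (sup±-isLub _) (sup±-isLub _)

theorem4 : (em : ExcludedMiddle 0ℓ) (R : CompleteOrderedField) →
  let open CompleteOrderedField R
      open LatticeExponents em R
  in (A : Matrix) →
     det A ≉ 0# →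
     A 0F 0F ≉ 0# →
     A 1F 1F ≉ 0# →
     Irrational (A 0F 1F / A 0F 0F) →
     Irrational (A 1F 0F / A 1F 1F) →
     𝔊[ ω̄ (A ℤ²) ]* ≤± ω (A ℤ²)
theorem4 = Lattice.𝔊[ω̄]*≤ω
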